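{- Let $n\ge 8$ and let $P_{\mathcal C}(n)=\mathrm{conv}\{(x,y)\in\mathbb R^2:\ \exists G \text{ a connected graph of order } n \text{ with } \alpha(G)=x,\ F(G)=y\}$. Then the polytope $P_{\mathcal C}(n)$ has exactly $n-1$ facets, defined by the inequalities \[ y\ge (2^k-1)x+2^k(1-k)+n,\quad k=1,2,\dots,n-2, \] and \[ y\le \frac{2^{n-1}-n}{n-2}(x-1)+n+1. \]
   Context: Graphs are finite, simple, undirected. $\alpha(G)$ is the stability number of $G$ and $F(G)$ (the Fibonacci index) is the number of stable sets of $G$ including the empty set. conv denotes convex hull.
   Formalization: The convex hull and the halfspaces are taken in the rational plane instead of R²; "exactly n-1 facets" is stated as: the inequalities describe the polytope, each is tight at two distinct points of it, and distinct inequalities have distinct faces. -}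

module Defs where

open import Data.Bool using (Bool; true; false; _∧_; not; if_then_else_)
open import Data.Nat as ℕ using (ℕ; zero; suc; _∸_; _⊔_; _^_)
open import Data.Fin using (Fin)
open import Data.Vec using (Vec; []; _∷_; lookup)
open import Data.List using (List; []; _∷_; map; _++_; length; filter; foldr; allFin)
open import Data.Integer as ℤ using (ℤ; +_)
open import Data.Rational using (ℚ; _/_; _+_; _*_; _≤_; 0ℚ; 1ℚ)
open import Data.Product using (_×_; _,_; ∃; Σ-syntax)
open import Relation.Binary.PropositionalEquality using (_≡_)
open import Relation.Nullary using (¬_)

record Graph (n : ℕ) : Set where
  field
    adj     : Fin n → Fin n → Bool
    adj-sym : ∀ i j → adj i j ≡ adj j i
    irrefl  : ∀ i → adj i i ≡ false
open Graph public

data Reach {n : ℕ} (G : Graph n) : Fin n → Fin n → Set where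
  here : ∀ {i} → Reach G i i
  step : ∀ {i j k} → adj G i j ≡ true → Reach G j k → Reach G i k

Connected : ∀ {n} → Graph n → Set
Connected G = ∀ i j → Reach G i j

allSubsets : (n : ℕ) → List (Vec Bool n)
allSubsets zero = [] ∷ []
allSubsets (suc n) = map (false ∷_) (allSubsets n) ++ map (true ∷_) (allSubsets n)

size : ∀ {n} → Vec Bool n → ℕ
size [] = 0
size (false ∷ s) = size s
size (true ∷ s) = suc (size s)

allB : ∀ {A : Set} → (A → Bool) → List A → Bool
allB p [] = true
allB p (x ∷ xs) = p x ∧ allB p xs

isStable : ∀ {n} → Graph n → Vec Bool n → Bool
isStable {n} G s =
  allB (λ i → allB (λ j → not (lookup s i ∧ lookup s j ∧ adj G i j)) (allFin n)) (allFin n)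

stableSets : ∀ {n} → Graph n → List (Vec Bool n)
stableSets {n} G = filter (λ s → isStable G s Data.Bool.≟ true) (allSubsets n)
  where import Data.Bool

-- Fibonacci index: number of stable sets (including the empty set)
F : ∀ {n} → Graph n → ℕ
F G = length (stableSets G)

α : ∀ {n} → Graph n → ℕ
α G = foldr _⊔_ 0 (map size (stableSets G))

Point : Set
Point = ℚ × ℚ

ℕ→ℚ : ℕ → ℚ
ℕ→ℚ m = + m / 1

ℤ→ℚ : ℤ → ℚ
ℤ→ℚ z = z / 1

Realised : ℕ → Point → Set
Realised n (x , y) = ∃ λ (G : Graph n) → Connected G × x ≡ ℕ→ℚ (α G) × y ≡ ℕ→ℚ (F G)

sumW : List (ℚ × Point) → ℚ
sumW [] = 0ℚ
sumW ((l , _) ∷ ws) = l + sumW ws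

combX : List (ℚ × Point) → ℚ
combX [] = 0ℚ
combX ((l , (x , _)) ∷ ws) = l * x + combX ws

combY : List (ℚ × Point) → ℚ
combY [] = 0ℚ
combY ((l , (_ , y)) ∷ ws) = l * y + combY ws

data AllOK (S : Point → Set) : List (ℚ × Point) → Set where
  []  : AllOK S []
  _∷_ : ∀ {l p ws} → (0ℚ ≤ l × S p) → AllOK S ws → AllOK S ((l , p) ∷ ws)

InConv : (Point → Set) → Point → Set
InConv S (x , y) = ∃ λ (ws : List (ℚ × Point)) →
  AllOK S ws × sumW ws ≡ 1ℚ × combX ws ≡ x × combY ws ≡ y

-- P_C(n) (intersected with ℚ²)
PC : ℕ → Point → Set
PC n = InConv (Realised n)

data Ineq (n : ℕ) : Set where
  lower : Fin (n ∸ 2) → Ineq n   -- index i stands for k = i + 1 ∈ {1,…,n-2}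
  upper : Ineq n

lowerRHS : ℕ → ℕ → ℚ → ℚ
lowerRHS n k x =
  ℤ→ℚ (+ (2 ^ k) ℤ.- + 1) * x + ℤ→ℚ (+ (2 ^ k) ℤ.* (+ 1 ℤ.- + k)) + ℕ→ℚ n

-- y ≤ (2^(n-1) - n)/(n-2) (x - 1) + n + 1, multiplied out by n - 2 > 0:
--   (n-2) y ≤ (2^(n-1) - n)(x - 1) + (n-2)(n+1)
upperLHS : ℕ → ℚ → ℚ
upperLHS n y = ℕ→ℚ (n ∸ 2) * y

upperRHS : ℕ → ℚ → ℚ
upperRHS n x =
  ℤ→ℚ (+ (2 ^ (n ∸ 1)) ℤ.- + n) * (x Data.Rational.- 1ℚ) + ℕ→ℚ (n ∸ 2) * ℕ→ℚ (n ℕ.+ 1)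

kOf : (n : ℕ) → Fin (n ∸ 2) → ℕ
kOf _ i = suc (Data.Fin.toℕ i)

Holds : (n : ℕ) → Ineq n → Point → Set
Holds n (lower i) (x , y) = lowerRHS n (kOf n i) x ≤ y
Holds n upper     (x , y) = upperLHS n y ≤ upperRHS n x

Tight : (n : ℕ) → Ineq n → Point → Set
Tight n (lower i) (x , y) = y ≡ lowerRHS n (kOf n i) x
Tight n upper     (x , y) = upperLHS n y ≡ upperRHS n x

{-# OPTIONS --safe #-}
-- A stable set of size α together with the n - α remaining single vertices gives F ≥ 2^α + n - α,
-- and the lower inequalities say that 2^α lies above the chords of the convex function 2^k.  Split
-- graphs attain this bound, so all vertices V_k = (k , 2^k + n - k) are realised, and the points
-- V_1 and V_{n-1} span the upper edge.
--
-- For the upper inequality let v be a vertex of large degree d; then F(G) ≤ F(G - v) + F(G - N[v]).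
-- Both terms are bounded by Turán's theorem for stable sets: among the graphs with at most m vertices and
-- stability number at most a, disjoint unions of a balanced cliques have the most stable sets.  The edges of
-- a connected graph are covered by the n - α vertices outside a maximum stable set, so some vertex has
-- degree at least (n - 1) / (n - α).  For 2 ≤ α ≤ n - 3, d = 2 suffices except for (n , α) = (8 , 4), (8 , 5),
-- (9 , 6): for fixed α, passing from n to n + 1 multiplies the Turán bounds by at most 3/2, less than the growth
-- of the right-hand side.
--
-- Conversely, a point satisfying the inequalities has 1 ≤ x ≤ n - 1 and lies vertically between the
-- chord V_k V_{k+1} with k ≤ x ≤ k + 1 and the chord V_1 V_{n-1}.

module Submission where

open import Defs
open import Data.Bool as Bool using (Bool; true; false; _∧_; _∨_; not; T)
open import Data.Bool.Properties using (∧-comm)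
open import Data.Nat using (ℕ; zero; suc; _+_; _*_; _∸_; _^_; _⊔_; _≤_; _<_; z≤n; s≤s; s≤s⁻¹; _≤?_; _≤ᵇ_)
open import Data.Nat.Properties renaming (_≟_ to _≟ℕ_)
open import Data.Nat.Solver using (module +-*-Solver)
open import Data.Fin using (Fin; zero; suc; toℕ; fromℕ<; _≟_)
open import Data.Fin.Properties using (any?; toℕ-fromℕ<; toℕ<n; toℕ-injective)
open import Data.Integer as ℤ using (ℤ; 1ℤ)
import Data.Integer.Properties as ℤ
import Data.Integer.Solver as ℤ
open import Data.Rational as ℚ using (ℚ; 0ℚ; 1ℚ; toℚᵘ; 1/_; Positive; NonZero)
  renaming (_+_ to _+ℚ_; _*_ to _*ℚ_; _-_ to _-ℚ_; -_ to -ℚ_; _≤_ to _≤ℚ_)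
import Data.Rational.Properties as ℚ
import Data.Rational.Solver as ℚ
import Data.Rational.Unnormalised as ℚᵘ
import Data.Rational.Unnormalised.Properties as ℚᵘ
open import Data.Vec using (Vec; []; _∷_; lookup; _[_]≔_; replicate)
open import Data.Vec.Properties using (lookup∘updateAt; lookup∘updateAt′; lookup-replicate)
open import Data.List using (List; []; _∷_; map; _++_; length; filter; foldr; allFin)
open import Data.List.Properties using (filter-++; length-++)
open import Data.List.Membership.Propositional using (_∈_)
open import Data.List.Membership.Propositional.Properties using (∈-allFin; ∈-map⁺; ∈-++⁺ˡ; ∈-++⁺ʳ)
open import Data.List.Relation.Unary.Any using (here; there)
open import Data.Product using (_×_; _,_; proj₁; proj₂; ∃; ∃₂)
open import Data.Sum using (_⊎_; inj₁; inj₂)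
open import Data.Empty using (⊥; ⊥-elim)
open import Function using (_∘_; _⟨_⟩_)
open import Function.Bundles using (_⇔_; mk⇔)
open import Relation.Nullary using (¬_; Dec; yes; no; does)
open import Relation.Nullary.Decidable using (_×-dec_)
open import Relation.Binary.PropositionalEquality using (_≡_; _≢_; refl; sym; trans; cong; cong₂; subst; subst₂; module ≡-Reasoning)
open import Relation.Binary.Definitions using (tri<; tri≈; tri>)
open import Algebra.Properties.CommutativeMonoid.Sum +-0-commutativeMonoid using (sum; ∑-distrib-+; sum-cong-≗)
open +-*-Solver using (solve; _:=_; _:+_; _:*_; con)

-- Connectivity is indispensable for the upper inequality: for `α = n - 1`, Turán's bound alone
-- gives `3 * 2 ^ (n - 2)`, more than the required `2 ^ (n - 1) + 1`. It is used through degrees,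
-- which make the second branch small. The factor 3/2 arises as follows. One more vertex enlarges a
-- clique of some order `p ≥ 1`, which has `p + 1` stable sets, to one with `p + 2`. The right-hand
-- side is dominated by `2 ^ (n - 1) * (α - 1) / (n - 2)`, which grows by `2 * (n - 2) / (n - 1)`,
-- at least 12/7 for `n ≥ 8`. Hence a single order has to be checked for each `α`. In the plane a
-- facet is an edge: a valid inequality defines one if it is tight at two distinct points of the
-- polygon and not at all of them. The facets are as many as the inequalities once any two
-- inequalities are told apart by a point of the polygon which is tight for the one and not for the
-- other.

module ℤS = ℤ.+-*-Solver
module ℚS = ℚ.+-*-Solver

-- Sums over vertices and cardinalities of vertex sets

⟦_⟧ : Bool → ℕ
⟦ true ⟧ = 1
⟦ false ⟧ = 0

VertexSet : ℕ → Set
VertexSet n = Fin n → Bool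

# : ∀ {n} → VertexSet n → ℕ
# S = sum (λ i → ⟦ S i ⟧)

sum-mono : ∀ {n} {f g : Fin n → ℕ} → (∀ i → f i ≤ g i) → sum f ≤ sum g
sum-mono {zero} f≤g = z≤n
sum-mono {suc n} f≤g = +-mono-≤ (f≤g zero) (sum-mono (f≤g ∘ suc))

sum-δ : ∀ {n} (v : Fin n) (g : Fin n → ℕ) → sum (λ i → g i * ⟦ does (i ≟ v) ⟧) ≡ g v
sum-δ {suc n} zero g = trans (cong₂ _+_ (*-identityʳ (g zero)) (sum-zero (λ i → *-zeroʳ (g (suc i))))) (+-identityʳ _)
  where
  sum-zero : ∀ {m} {f : Fin m → ℕ} → (∀ i → f i ≡ 0) → sum f ≡ 0
  sum-zero {zero} _ = refl
  sum-zero {suc m} e = cong₂ _+_ (e zero) (sum-zero (e ∘ suc))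
sum-δ (suc v) g = cong₂ _+_ (*-zeroʳ (g zero)) (sum-δ v (g ∘ suc))

#-singleton : ∀ {n} (v : Fin n) → # (λ i → does (i ≟ v)) ≡ 1
#-singleton {n} v = trans (sum-cong-≗ {n} (λ i → sym (*-identityˡ _))) (sum-δ v (λ _ → 1))

size-∅ : ∀ m → size (replicate m false) ≡ 0
size-∅ zero = refl
size-∅ (suc m) = size-∅ m

size≡# : ∀ {n} (s : Vec Bool n) → size s ≡ # (lookup s)
size≡# [] = refl
size≡# (false ∷ s) = size≡# s
size≡# (true ∷ s) = cong suc (size≡# s)

#-full : ∀ n → # {n} (λ _ → true) ≡ n
#-full zero = refl
#-full (suc n) = cong suc (#-full n)

#≡0⇒∉ : ∀ {n} (S : VertexSet n) → # S ≡ 0 → ∀ i → S i ≡ false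
#≡0⇒∉ S e zero with S zero
... | false = refl
#≡0⇒∉ S e (suc i) with S zero
... | false = #≡0⇒∉ (S ∘ suc) e i

nonempty? : ∀ {n} (S : VertexSet n) → (∃ λ v → S v ≡ true) ⊎ # S ≡ 0
nonempty? {zero} S = inj₂ refl
nonempty? {suc n} S with S zero in eq
... | true = inj₁ (zero , eq)
... | false with nonempty? (S ∘ suc)
...   | inj₁ (v , v∈S) = inj₁ (suc v , v∈S)
...   | inj₂ e = inj₂ e

∧-true : ∀ {a b} → a ∧ b ≡ true → a ≡ true × b ≡ true
∧-true {true} {true} _ = refl , refl

not-true : ∀ {b} → not b ≡ true → b ≡ false
not-true {false} _ = refl

true≢false : ∀ {b : Bool} → b ≡ true → b ≡ false → ⊥
true≢false refl ()

sum-full : ∀ n c → sum {n} (λ _ → c) ≡ n * c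
sum-full zero c = refl
sum-full (suc n) c = cong (c +_) (sum-full n c)

sum-*ʳ : ∀ {n} (f : Fin n → ℕ) c → sum (λ i → f i * c) ≡ sum f * c
sum-*ʳ {zero} f c = refl
sum-*ʳ {suc n} f c = trans (cong (f zero * c +_) (sum-*ʳ (f ∘ suc) c)) (sym (*-distribʳ-+ c (f zero) _))

-- Counting Boolean vectors

cnt : ∀ {n} → (Vec Bool n → Bool) → ℕ
cnt {zero} p = ⟦ p [] ⟧
cnt {suc n} p = cnt (p ∘ (false ∷_)) + cnt (p ∘ (true ∷_))

length-filter≡cnt : ∀ {n} (p : Vec Bool n → Bool) →
  length (filter (λ s → p s Bool.≟ true) (allSubsets n)) ≡ cnt p
length-filter≡cnt {zero} p with p []
... | true = refl
... | false = refl
length-filter≡cnt {suc n} p =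
  trans (cong length (filter-++ P? (map (false ∷_) (allSubsets n)) _))
  (trans (length-++ (filter P? (map (false ∷_) (allSubsets n))))
  (cong₂ _+_ (trans (filter-∘ (false ∷_) (allSubsets n)) (length-filter≡cnt (p ∘ (false ∷_))))
             (trans (filter-∘ (true ∷_) (allSubsets n)) (length-filter≡cnt (p ∘ (true ∷_))))))
  where
  P? = λ s → p s Bool.≟ true
  filter-∘ : (f : Vec Bool n → Vec Bool (suc n)) (xs : List (Vec Bool n)) →
    length (filter P? (map f xs)) ≡ length (filter (λ s → p (f s) Bool.≟ true) xs)
  filter-∘ f [] = refl
  filter-∘ f (x ∷ xs) with p (f x) Bool.≟ true
  ... | yes _ = cong suc (filter-∘ f xs)
  ... | no _ = filter-∘ f xs

cnt-none : ∀ {n} {p : Vec Bool n → Bool} → (∀ s → p s ≡ false) → cnt p ≡ 0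
cnt-none {zero} h rewrite h [] = refl
cnt-none {suc n} h = cong₂ _+_ (cnt-none (h ∘ (false ∷_))) (cnt-none (h ∘ (true ∷_)))

-- Deleting `v` is a bijection from the vectors containing `v` to those avoiding it, with inverse
-- `s [ v ]≔ true`. Both summands can therefore range over vectors avoiding `v`.
cnt-split : ∀ {n} (v : Fin n) (p : Vec Bool n → Bool) →
  cnt p ≡ cnt (λ s → not (lookup s v) ∧ p s) + cnt (λ s → not (lookup s v) ∧ p (s [ v ]≔ true))
cnt-split {suc n} zero p =
  sym (cong₂ _+_ (trans (cong (cnt (p ∘ (false ∷_)) +_) (cnt-none {n} (λ _ → refl))) (+-identityʳ _))
                 (trans (cong (cnt (p ∘ (true ∷_)) +_) (cnt-none {n} (λ _ → refl))) (+-identityʳ _)))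
cnt-split {suc n} (suc v) p rewrite cnt-split v (p ∘ (false ∷_)) | cnt-split v (p ∘ (true ∷_)) =
  solve 4 (λ a b c d → (a :+ b) :+ (c :+ d) := (a :+ c) :+ (b :+ d)) refl
    (cnt (λ s → not (lookup s v) ∧ p (false ∷ s))) _ _ _

-- Stable sets, `F` and `α`

Stable : ∀ {n} → Graph n → Vec Bool n → Set
Stable G s = ∀ i j → lookup s i ≡ true → lookup s j ≡ true → adj G i j ≡ false

allB⁻ : ∀ {A : Set} (p : A → Bool) {xs} → allB p xs ≡ true → ∀ {x} → x ∈ xs → p x ≡ true
allB⁻ p h (here refl) = proj₁ (∧-true h)
allB⁻ p {y ∷ ys} h (there x∈ys) = allB⁻ p (proj₂ (∧-true {p y} h)) x∈ys

allB⁺ : ∀ {A : Set} (p : A → Bool) xs → (∀ x → p x ≡ true) → allB p xs ≡ true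
allB⁺ p [] h = refl
allB⁺ p (x ∷ xs) h rewrite h x = allB⁺ p xs h

module _ {n : ℕ} (G : Graph n) where

  isStable⇒Stable : ∀ s → isStable G s ≡ true → Stable G s
  isStable⇒Stable s h i j si sj = lemma (allB⁻ _ (allB⁻ _ h (∈-allFin i)) (∈-allFin j)) si sj
    where
    lemma : ∀ {a b c} → not (a ∧ b ∧ c) ≡ true → a ≡ true → b ≡ true → c ≡ false
    lemma {c = false} _ refl refl = refl

  Stable⇒isStable : ∀ s → Stable G s → isStable G s ≡ true
  Stable⇒isStable s st = allB⁺ _ (allFin n) λ i → allB⁺ _ (allFin n) λ j → lemma (st i j)
    where
    lemma : ∀ {a b c} → (a ≡ true → b ≡ true → c ≡ false) → not (a ∧ b ∧ c) ≡ true
    lemma {false} _ = refl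
    lemma {true} {false} _ = refl
    lemma {true} {true} h rewrite h refl refl = refl

  F≡cnt : F G ≡ cnt (isStable G)
  F≡cnt = length-filter≡cnt (isStable G)

  size≤α : ∀ s → Stable G s → size s ≤ α G
  size≤α s st = go (allSubsets n) (∈-allSubsets s)
    where
    ∈-allSubsets : ∀ {m} (t : Vec Bool m) → t ∈ allSubsets m
    ∈-allSubsets [] = here refl
    ∈-allSubsets (false ∷ t) = ∈-++⁺ˡ (∈-map⁺ (false ∷_) (∈-allSubsets t))
    ∈-allSubsets {suc m} (true ∷ t) = ∈-++⁺ʳ (map (false ∷_) (allSubsets m)) (∈-map⁺ (true ∷_) (∈-allSubsets t))
    go : ∀ xs → s ∈ xs → size s ≤ foldr _⊔_ 0 (map size (filter (λ t → isStable G t Bool.≟ true) xs))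
    go (x ∷ xs) s∈ with isStable G x Bool.≟ true
    go (x ∷ xs) (here refl) | yes _ = m≤m⊔n (size s) _
    go (x ∷ xs) (there e) | yes _ = ≤-trans (go xs e) (m≤n⊔m (size x) _)
    go (x ∷ xs) (here refl) | no ¬st = ⊥-elim (¬st (Stable⇒isStable s st))
    go (x ∷ xs) (there e) | no _ = go xs e

  α-attained : ∃ λ s → Stable G s × size s ≡ α G
  α-attained = go (allSubsets n)
    where
    empty : Vec Bool n
    empty = replicate n false
    ∅-stable : Stable G empty
    ∅-stable i _ i∈∅ _ = ⊥-elim (true≢false i∈∅ (lookup-replicate i false))
    go : ∀ xs → ∃ λ s → Stable G s × size s ≡ foldr _⊔_ 0 (map size (filter (λ t → isStable G t Bool.≟ true) xs))
    go [] = empty , ∅-stable , size-∅ n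
    go (x ∷ xs) with isStable G x Bool.≟ true
    ... | no _ = go xs
    ... | yes st with go xs | ≤-total (size x) (foldr _⊔_ 0 (map size (filter (λ t → isStable G t Bool.≟ true) xs)))
    ...   | s , s-st , e | inj₁ le = s , s-st , trans e (sym (m≤n⇒m⊔n≡n le))
    ...   | _ | inj₂ ge = x , isStable⇒Stable x st , sym (m≥n⇒m⊔n≡m ge)

cnt≤1 : ∀ {n} {p : Vec Bool n → Bool} → (∀ s → p s ≡ true → ∀ i → lookup s i ≡ false) → cnt p ≤ 1
cnt≤1 {zero} {p} h with p []
... | true = ≤-refl
... | false = z≤n
cnt≤1 {suc n} {p} h =
  +-mono-≤ (cnt≤1 (λ s e i → h (false ∷ s) e (suc i))) (≤-reflexive (cnt-none λ s → excluded s (p (true ∷ s)) refl))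
  where
  excluded : ∀ s b → p (true ∷ s) ≡ b → p (true ∷ s) ≡ false
  excluded s true e = ⊥-elim (true≢false refl (h (true ∷ s) e zero))
  excluded s false e = e

-- Branching at a vertex and Turán's theorem for stable sets

_⊆_ : ∀ {n} → Vec Bool n → VertexSet n → Set
s ⊆ S = ∀ i → lookup s i ≡ true → S i ≡ true

_∖_ : ∀ {n} → VertexSet n → Fin n → VertexSet n
(S ∖ v) i = S i ∧ not (does (i ≟ v))

∖-⊆ : ∀ {n} (S : VertexSet n) v i → (S ∖ v) i ≡ true → S i ≡ true
∖-⊆ S v i h = proj₁ (∧-true {S i} h)

size-insert : ∀ {n} (s : Vec Bool n) v → lookup s v ≡ false → size (s [ v ]≔ true) ≡ suc (size s)
size-insert (false ∷ s) zero _ = refl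
size-insert (true ∷ s) (suc v) h = cong suc (size-insert s v h)
size-insert (false ∷ s) (suc v) h = size-insert s v h

≟-refl : ∀ {n} (v : Fin n) → does (v ≟ v) ≡ true
≟-refl v with v ≟ v
... | yes _ = refl
... | no v≢v = ⊥-elim (v≢v refl)

∈-insert⁻ : ∀ {n} (s : Vec Bool n) v i → lookup (s [ v ]≔ true) i ≡ true → i ≡ v ⊎ (i ≢ v × lookup s i ≡ true)
∈-insert⁻ s v i h with i ≟ v
... | yes i≡v = inj₁ i≡v
... | no i≢v = inj₂ (i≢v , trans (sym (lookup∘updateAt′ i v i≢v s)) h)

∈-insert⁺ : ∀ {n} (s : Vec Bool n) v i → lookup s i ≡ true → lookup (s [ v ]≔ true) i ≡ true
∈-insert⁺ s v i h with i ≟ v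
... | yes refl = lookup∘updateAt v s
... | no i≢v = trans (lookup∘updateAt′ i v i≢v s) h

module _ {n : ℕ} (G : Graph n) where

  _∖N_ : VertexSet n → Fin n → VertexSet n
  (S ∖N v) i = S i ∧ not (does (i ≟ v)) ∧ not (adj G v i)

  deg : VertexSet n → Fin n → ℕ
  deg S v = # (λ i → S i ∧ adj G v i)

  -- The stability number of the subgraph induced on `S`, expressed by stable sets of `G` so that
  -- induced subgraphs need not be constructed.
  α≤ : VertexSet n → ℕ → Set
  α≤ S a = ∀ s → Stable G s → s ⊆ S → size s ≤ a

  -- S contains at most b stable sets; ranging over all families p of stable subsets of S
  -- makes a Boolean test for s ⊆ S unnecessary.
  F≤ : VertexSet n → ℕ → Set
  F≤ S b = ∀ p → (∀ s → p s ≡ true → Stable G s × s ⊆ S) → cnt p ≤ b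

  #-∖ : ∀ S v → S v ≡ true → suc (# (S ∖ v)) ≡ # S
  #-∖ S v v∈S =
    trans (cong (_+ # (S ∖ v)) (sym (#-singleton v)))
    (trans (sym (∑-distrib-+ (λ i → ⟦ does (i ≟ v) ⟧) (λ i → ⟦ (S ∖ v) i ⟧)))
           (sum-cong-≗ {n} pointwise))
    where
    pointwise : ∀ i → ⟦ does (i ≟ v) ⟧ + ⟦ (S ∖ v) i ⟧ ≡ ⟦ S i ⟧
    pointwise i with i ≟ v
    ... | yes refl rewrite v∈S = refl
    ... | no _ with S i
    ...   | true = refl
    ...   | false = refl

  #-∖N : ∀ S v → S v ≡ true → suc (deg S v + # (S ∖N v)) ≡ # S
  #-∖N S v v∈S =
    trans (cong₂ _+_ (sym (#-singleton v)) (sym (∑-distrib-+ (λ i → ⟦ S i ∧ adj G v i ⟧) (λ i → ⟦ (S ∖N v) i ⟧))))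
    (trans (sym (∑-distrib-+ (λ i → ⟦ does (i ≟ v) ⟧) (λ i → ⟦ S i ∧ adj G v i ⟧ + ⟦ (S ∖N v) i ⟧)))
           (sum-cong-≗ {n} pointwise))
    where
    pointwise : ∀ i → ⟦ does (i ≟ v) ⟧ + (⟦ S i ∧ adj G v i ⟧ + ⟦ (S ∖N v) i ⟧) ≡ ⟦ S i ⟧
    pointwise i with i ≟ v
    ... | yes refl rewrite v∈S | irrefl G v = refl
    ... | no _ with S i | adj G v i
    ...   | true | true = refl
    ...   | true | false = refl
    ...   | false | _ = refl

  ∖N-∉ : ∀ S v i → (S ∖N v) i ≡ true → S i ≡ true × i ≢ v × adj G v i ≡ false
  ∖N-∉ S v i h with S i | i ≟ v | adj G v i
  ... | true | no i≢v | false = refl , i≢v , refl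

  α≤-∖ : ∀ {S v a} → α≤ S a → α≤ (S ∖ v) a
  α≤-∖ {S} {v} h s st s⊆ = h s st (λ i i∈s → ∖-⊆ S v i (s⊆ i i∈s))

  insert-stable : ∀ S v s → Stable G s → s ⊆ (S ∖N v) → Stable G (s [ v ]≔ true)
  insert-stable S v s st s⊆ i j i∈ j∈ with ∈-insert⁻ s v i i∈ | ∈-insert⁻ s v j j∈
  ... | inj₁ refl | inj₁ refl = irrefl G v
  ... | inj₁ refl | inj₂ (_ , j∈s) = proj₂ (proj₂ (∖N-∉ S v j (s⊆ j j∈s)))
  ... | inj₂ (_ , i∈s) | inj₁ refl = trans (adj-sym G i v) (proj₂ (proj₂ (∖N-∉ S v i (s⊆ i i∈s))))
  ... | inj₂ (_ , i∈s) | inj₂ (_ , j∈s) = st i j i∈s j∈s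

  -- Adding `v` to a stable subset of `S ∖N v` gives a stable subset of `S` with one more element.
  α≤-∖N : ∀ {S v a} → S v ≡ true → α≤ S (suc a) → α≤ (S ∖N v) a
  α≤-∖N {S} {v} {a} v∈S h s st s⊆ =
    s≤s⁻¹ (subst (_≤ suc a) (size-insert s v v∉s) (h (s [ v ]≔ true) (insert-stable S v s st s⊆) s′⊆S))
    where
    v∉s : lookup s v ≡ false
    v∉s with lookup s v in eq
    ... | false = refl
    ... | true = ⊥-elim (proj₁ (proj₂ (∖N-∉ S v v (s⊆ v eq))) refl)
    s′⊆S : (s [ v ]≔ true) ⊆ S
    s′⊆S i i∈ with ∈-insert⁻ s v i i∈
    ... | inj₁ refl = v∈S
    ... | inj₂ (_ , i∈s) = proj₁ (∖N-∉ S v i (s⊆ i i∈s))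

  -- A stable set avoiding `v` lies in `S ∖ v`; one containing `v` has no neighbour of `v`, so
  -- without `v` it lies in `S ∖N v`.
  F≤-branch : ∀ {S v b c} → F≤ (S ∖ v) b → F≤ (S ∖N v) c → F≤ S (b + c)
  F≤-branch {S} {v} {b} {c} hb hc p fam =
    ≤-trans (≤-reflexive (cnt-split v p)) (+-mono-≤ (hb _ without) (hc _ with′))
    where
    without : ∀ s → not (lookup s v) ∧ p s ≡ true → Stable G s × s ⊆ (S ∖ v)
    without s h with ∧-true {not (lookup s v)} h
    ... | v∉s , ps = proj₁ (fam s ps) , sub
      where
      sub : s ⊆ (S ∖ v)
      sub i i∈s rewrite proj₂ (fam s ps) i i∈s with i ≟ v
      ... | no _ = refl
      ... | yes refl = ⊥-elim (true≢false i∈s (not-true v∉s))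
    with′ : ∀ s → not (lookup s v) ∧ p (s [ v ]≔ true) ≡ true → Stable G s × s ⊆ (S ∖N v)
    with′ s h with ∧-true {not (lookup s v)} h
    ... | v∉s , ps = (λ i j i∈ j∈ → st i j (∈-insert⁺ s v i i∈) (∈-insert⁺ s v j j∈)) , sub
      where
      st : Stable G (s [ v ]≔ true)
      st = proj₁ (fam _ ps)
      sub : s ⊆ (S ∖N v)
      sub i i∈s rewrite proj₂ (fam _ ps) i (∈-insert⁺ s v i i∈s)
                      | st v i (lookup∘updateAt v s) (∈-insert⁺ s v i i∈s) with i ≟ v
      ... | no _ = refl
      ... | yes refl = ⊥-elim (true≢false i∈s (not-true v∉s))

  F≤-empty : ∀ {S} → # S ≡ 0 → F≤ S 1
  F≤-empty {S} e p fam = cnt≤1 λ s ps i → case-∉ s ps i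
    where
    case-∉ : ∀ s → p s ≡ true → ∀ i → lookup s i ≡ false
    case-∉ s ps i with lookup s i in eq
    ... | false = refl
    ... | true = ⊥-elim (true≢false (proj₂ (fam s ps) i eq) (#≡0⇒∉ S e i))

  F≤-weaken : ∀ {S b c} → b ≤ c → F≤ S b → F≤ S c
  F≤-weaken b≤c h p fam = ≤-trans (h p fam) b≤c

  deg-mono : ∀ {S S′ : VertexSet n} → (∀ i → S i ≡ true → S′ i ≡ true) → ∀ v → deg S v ≤ deg S′ v
  deg-mono {S} {S′} h v = sum-mono {n} pointwise
    where
    pointwise : ∀ i → ⟦ S i ∧ adj G v i ⟧ ≤ ⟦ S′ i ∧ adj G v i ⟧
    pointwise i with S i | h i
    ... | false | _ = z≤n
    ... | true | h′ rewrite h′ refl = ≤-refl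

  -- A greedily built stable set uses up at most q vertices per step.
  greedy : ∀ q a S → (∀ v → S v ≡ true → deg S v < q) → α≤ S a → # S ≤ a * q
  greedy q zero S _ h with nonempty? S
  ... | inj₂ e = ≤-reflexive e
  ... | inj₁ (v , v∈S) = ⊥-elim (n≮0 (subst (_≤ 0) size-v (h (∅ [ v ]≔ true) v-stable v-⊆)))
    where
    ∅ : Vec Bool n
    ∅ = replicate n false
    empty : ∀ i → lookup ∅ i ≡ true → ⊥
    empty i i∈ = true≢false i∈ (lookup-replicate i false)
    v-stable : Stable G (∅ [ v ]≔ true)
    v-stable = insert-stable S v ∅ (λ i _ i∈ _ → ⊥-elim (empty i i∈)) (λ i i∈ → ⊥-elim (empty i i∈))
    v-⊆ : (∅ [ v ]≔ true) ⊆ S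
    v-⊆ i i∈ with ∈-insert⁻ ∅ v i i∈
    ... | inj₁ refl = v∈S
    ... | inj₂ (_ , i∈∅) = ⊥-elim (empty i i∈∅)
    size-v : size (∅ [ v ]≔ true) ≡ suc (size ∅)
    size-v = size-insert ∅ v (lookup-replicate v false)
  greedy q (suc a) S small h with nonempty? S
  ... | inj₂ e = subst (_≤ suc a * q) (sym e) z≤n
  ... | inj₁ (v , v∈S) = subst (_≤ suc a * q) (#-∖N S v v∈S)
    (+-mono-≤ (small v v∈S) (greedy q a (S ∖N v) small′ (α≤-∖N v∈S h)))
    where
    small′ : ∀ u → (S ∖N v) u ≡ true → deg (S ∖N v) u < q
    small′ u u∈ = ≤-<-trans (deg-mono (λ i i∈ → proj₁ (∖N-∉ S v i i∈)) u)
                            (small u (proj₁ (∖N-∉ S v u u∈)))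

  large-degree? : ∀ S q → (∃ λ v → S v ≡ true × q ≤ deg S v) ⊎ (∀ v → S v ≡ true → deg S v < q)
  large-degree? S q with any? (λ v → (S v Bool.≟ true) ×-dec (q ≤? deg S v))
  ... | yes found = inj₁ found
  ... | no none = inj₂ λ v v∈S → ≰⇒> λ q≤ → none (v , v∈S , q≤)

  -- The bound is attained by r disjoint cliques of order q + 1 and s of order q.
  turán : ∀ q r s S → # S ≤ q * (r + s) + r → α≤ S (r + s) → F≤ S (suc q ^ s * suc (suc q) ^ r)
  turán zero zero s S #S≤ _ = F≤-weaken (≤-reflexive (sym (trans (*-identityʳ (1 ^ s)) (^-zeroˡ s)))) (F≤-empty (n≤0⇒n≡0 #S≤))
  -- The `s` cliques of order `q + 1` are the larger ones at level `q`; the recursion descends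
  -- lexicographically in `q` and the number of larger cliques.
  turán (suc q) zero s S #S≤ h =
    F≤-weaken (≤-reflexive (*-comm 1 (suc (suc q) ^ s)))
      (turán q s 0 S (≤-trans #S≤ (≤-reflexive (solve 2 (λ q s → (con 1 :+ q) :* s :+ con 0 := q :* (s :+ con 0) :+ s) refl q s)))
                     (subst (α≤ S) (sym (+-identityʳ s)) h))
  turán q (suc r) s S #S≤ h with large-degree? S q
  -- If no degree reaches `q`, the greedy bound shows that cliques of order `q` alone have room for
  -- all of `S`.
  ... | inj₂ small = F≤-weaken bound
        (turán q zero (suc r + s) S
          (≤-trans (greedy q (suc (r + s)) S small h) (≤-reflexive (solve 2 (λ q t → t :* q := q :* t :+ con 0) refl q (suc r + s))))
          h)
    where
    bound : suc q ^ (suc r + s) * 1 ≤ suc q ^ s * suc (suc q) ^ suc r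
    bound = begin
      suc q ^ (suc r + s) * 1            ≡⟨ *-identityʳ _ ⟩
      suc q ^ (suc r + s)                ≡⟨ cong (suc q ^_) (+-comm (suc r) s) ⟩
      suc q ^ (s + suc r)                ≡⟨ ^-distribˡ-+-* (suc q) s (suc r) ⟩
      suc q ^ s * suc q ^ suc r          ≤⟨ *-monoʳ-≤ (suc q ^ s) (^-monoˡ-≤ (suc r) (n≤1+n (suc q))) ⟩
      suc q ^ s * suc (suc q) ^ suc r    ∎
      where open ≤-Reasoning
  -- In the clique union, deleting `v` shrinks one larger clique and deleting its closed
  -- neighbourhood removes that clique, so the branching recursion holds with equality there.
  ... | inj₁ (v , v∈S , q≤deg) = F≤-weaken (≤-reflexive eq)
        (F≤-branch {v = v} (turán q r (suc s) (S ∖ v) #₁ (subst (α≤ (S ∖ v)) (sym (+-suc r s)) (α≤-∖ {S} {v} h)))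
                   (turán q r s (S ∖N v) #₂ (α≤-∖N v∈S h)))
    where
    eq : suc q ^ suc s * suc (suc q) ^ r + suc q ^ s * suc (suc q) ^ r ≡ suc q ^ s * suc (suc q) ^ suc r
    eq = solve 3 (λ q x y → (con 1 :+ q) :* x :* y :+ x :* y := x :* ((con 2 :+ q) :* y)) refl
           q (suc q ^ s) (suc (suc q) ^ r)
    #₁ : # (S ∖ v) ≤ q * (r + suc s) + r
    #₁ = s≤s⁻¹ (begin
      suc (# (S ∖ v))               ≡⟨ #-∖ S v v∈S ⟩
      # S                           ≤⟨ #S≤ ⟩
      q * (suc r + s) + suc r       ≡⟨ cong (λ z → q * z + suc r) (sym (+-suc r s)) ⟩
      q * (r + suc s) + suc r       ≡⟨ +-suc _ r ⟩
      suc (q * (r + suc s) + r)     ∎)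
      where open ≤-Reasoning
    #₂ : # (S ∖N v) ≤ q * (r + s) + r
    #₂ = +-cancelˡ-≤ (suc q) _ _ (begin
      suc q + # (S ∖N v)              ≤⟨ s≤s (+-monoˡ-≤ (# (S ∖N v)) q≤deg) ⟩
      suc (deg S v + # (S ∖N v))      ≡⟨ #-∖N S v v∈S ⟩
      # S                             ≤⟨ #S≤ ⟩
      q * (suc r + s) + suc r         ≡⟨ solve 3 (λ q r s → q :* (con 1 :+ r :+ s) :+ (con 1 :+ r) := con 1 :+ q :+ (q :* (r :+ s) :+ r)) refl q r s ⟩
      suc q + (q * (r + s) + r)       ∎)
      where open ≤-Reasoning

-- Edges and degrees in connected graphs

_∪_ : ∀ {n} → VertexSet n → Fin n → VertexSet n
(R ∪ w) i = R i ∨ does (i ≟ w)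

#-∪ : ∀ {n} (R : VertexSet n) w → R w ≡ false → # (R ∪ w) ≡ suc (# R)
#-∪ {n} R w w∉R =
  trans (sum-cong-≗ {n} pointwise)
  (trans (∑-distrib-+ (λ i → ⟦ does (i ≟ w) ⟧) (λ i → ⟦ R i ⟧)) (cong (_+ # R) (#-singleton w)))
  where
  pointwise : ∀ i → ⟦ R i ∨ does (i ≟ w) ⟧ ≡ ⟦ does (i ≟ w) ⟧ + ⟦ R i ⟧
  pointwise i with i ≟ w
  ... | yes refl rewrite w∉R = refl
  ... | no _ with R i
  ...   | true = refl
  ...   | false = refl

#-complement : ∀ {n} (S : VertexSet n) → # S + # (not ∘ S) ≡ n
#-complement {n} S =
  trans (sym (∑-distrib-+ (λ i → ⟦ S i ⟧) (λ i → ⟦ not (S i) ⟧)))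
  (trans (sum-cong-≗ {n} pointwise) (#-full n))
  where
  pointwise : ∀ i → ⟦ S i ⟧ + ⟦ not (S i) ⟧ ≡ 1
  pointwise i with S i
  ... | true = refl
  ... | false = refl

module _ {n : ℕ} (G : Graph n) where

  crossing-edge : ∀ {i j} (R : VertexSet n) → Reach G i j → R i ≡ true → R j ≡ false →
    ∃₂ λ u w → R u ≡ true × R w ≡ false × adj G u w ≡ true
  crossing-edge R here i∈ i∉ = ⊥-elim (true≢false i∈ i∉)
  crossing-edge R (step {i} {j} e path) i∈ k∉ with R j in eq
  ... | true = crossing-edge R path eq k∉
  ... | false = i , j , i∈ , eq , e

  module _ (W : VertexSet n) where

    edge : VertexSet n → Fin n → Fin n → ℕ
    edge R i j = ⟦ W i ∧ R i ∧ R j ∧ adj G i j ⟧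

    -- the number of edges inside R, each counted once per endpoint in W
    edges : VertexSet n → ℕ
    edges R = sum (λ i → sum (edge R i))

    -- The edge between `u` and `w` appears as two ordered pairs that are new in `R ∪ w`, and each
    -- pair counts exactly when its first component is in `W`.
    edges-step : ∀ R u w → R u ≡ true → R w ≡ false → adj G u w ≡ true →
      edges R + (⟦ W u ⟧ + ⟦ W w ⟧) ≤ edges (R ∪ w)
    edges-step R u w u∈R w∉R uw = begin
      edges R + (⟦ W u ⟧ + ⟦ W w ⟧)
        ≡⟨ cong (edges R +_) (cong₂ _+_ (sym (sum-δ u (λ i → ⟦ W i ⟧))) (sym (sum-δ w (λ i → ⟦ W i ⟧)))) ⟩
      edges R + (sum (c u) + sum (c w))
        ≡⟨ cong (edges R +_) (sym (∑-distrib-+ (c u) (c w))) ⟩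
      edges R + sum (λ i → c u i + c w i)
        ≡⟨ sym (∑-distrib-+ (λ i → sum (edge R i)) (λ i → c u i + c w i)) ⟩
      sum (λ i → sum (edge R i) + (c u i + c w i))
        ≡⟨ sum-cong-≗ {n} inner ⟩
      sum (λ i → sum (λ j → edge R i j + (c u i * ⟦ does (j ≟ w) ⟧ + c w i * ⟦ does (j ≟ u) ⟧)))
        ≤⟨ sum-mono {n} (λ i → sum-mono {n} (pointwise i)) ⟩
      edges (R ∪ w) ∎
      where
      open ≤-Reasoning
      c : Fin n → Fin n → ℕ
      c v i = ⟦ W i ⟧ * ⟦ does (i ≟ v) ⟧
      inner : ∀ i → sum (edge R i) + (c u i + c w i)
        ≡ sum (λ j → edge R i j + (c u i * ⟦ does (j ≟ w) ⟧ + c w i * ⟦ does (j ≟ u) ⟧))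
      inner i = sym (trans (∑-distrib-+ (edge R i) (λ j → c u i * ⟦ does (j ≟ w) ⟧ + c w i * ⟦ does (j ≟ u) ⟧))
        (cong (sum (edge R i) +_) (trans (∑-distrib-+ (λ j → c u i * ⟦ does (j ≟ w) ⟧) (λ j → c w i * ⟦ does (j ≟ u) ⟧))
          (cong₂ _+_ (sum-δ w (λ _ → c u i)) (sum-δ u (λ _ → c w i))))))
      old : ∀ i j → edge R i j ≤ edge (R ∪ w) i j
      old i j with W i | R i | R j
      ... | false | _ | _ = z≤n
      ... | true | false | _ = z≤n
      ... | true | true | false = z≤n
      ... | true | true | true = ≤-refl
      u≢w : u ≢ w
      u≢w refl = true≢false u∈R w∉R
      uw-edge : edge R u w + (⟦ W u ⟧ * 1 * 1 + ⟦ W u ⟧ * 0 * 0) ≤ ⟦ W u ∧ (R u ∨ false) ∧ (R w ∨ true) ∧ adj G u w ⟧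
      uw-edge rewrite u∈R | w∉R | uw with W u
      ... | true = ≤-refl
      ... | false = ≤-refl
      wu-edge : edge R w u + (⟦ W w ⟧ * 0 * 0 + ⟦ W w ⟧ * 1 * 1) ≤ ⟦ W w ∧ (R w ∨ true) ∧ (R u ∨ false) ∧ adj G w u ⟧
      wu-edge rewrite u∈R | w∉R | adj-sym G w u | uw with W w
      ... | true = ≤-refl
      ... | false = ≤-refl
      none : ∀ {x y z} → z ≡ 0 → x ≤ y → x + z ≤ y
      none {x} refl x≤y = ≤-trans (≤-reflexive (+-identityʳ x)) x≤y
      a*0*b : ∀ a b → a * 0 * b ≡ 0
      a*0*b a b = cong (_* b) (*-zeroʳ a)
      pointwise : ∀ i j → edge R i j + (c u i * ⟦ does (j ≟ w) ⟧ + c w i * ⟦ does (j ≟ u) ⟧) ≤ edge (R ∪ w) i j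
      pointwise i j with i ≟ u | j ≟ w | i ≟ w | j ≟ u | old i j
      ... | yes refl | _ | yes refl | _ | _ = ⊥-elim (u≢w refl)
      ... | _ | yes refl | _ | yes refl | _ = ⊥-elim (u≢w refl)
      ... | yes refl | yes refl | no _ | no _ | _ = uw-edge
      ... | no _ | no _ | yes refl | yes refl | _ = wu-edge
      ... | no _ | q | no _ | t | le = none (cong₂ _+_ (a*0*b ⟦ W i ⟧ _) (a*0*b ⟦ W i ⟧ _)) le
      ... | no _ | q | yes _ | no _ | le = none (cong₂ _+_ (a*0*b ⟦ W i ⟧ _) (*-zeroʳ (⟦ W i ⟧ * 1))) le
      ... | yes _ | no _ | no _ | t | le = none (cong₂ _+_ (*-zeroʳ (⟦ W i ⟧ * 1)) (a*0*b ⟦ W i ⟧ _)) le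

    edges-mono-full : ∀ R → edges R ≤ edges (λ _ → true)
    edges-mono-full R = sum-mono {n} (λ i → sum-mono {n} (pointwise i))
      where
      pointwise : ∀ i j → edge R i j ≤ edge (λ _ → true) i j
      pointwise i j with W i | R i | R j
      ... | false | _ | _ = z≤n
      ... | true | false | _ = z≤n
      ... | true | true | false = z≤n
      ... | true | true | true = ≤-refl

    -- Growing R from a root along crossing edges gains at least k in the count per new vertex.
    spanning : ∀ k → Connected G → (∀ u w → adj G u w ≡ true → k ≤ ⟦ W u ⟧ + ⟦ W w ⟧) → Fin n →
      k * n ≤ k + edges (λ _ → true)
    spanning k conn cover r = explore (# (not ∘ root)) root (≟-refl r) refl (≤-trans (≤-reflexive start) (m≤m+n k _))
      where
      root : VertexSet n
      root i = does (i ≟ r)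
      start : k * # root ≡ k
      start = trans (cong (k *_) (#-singleton r)) (*-identityʳ k)
      finish : ∀ R → # (not ∘ R) ≡ 0 → k * # R ≤ k + edges R → k * n ≤ k + edges (λ _ → true)
      finish R e inv = begin
        k * n                    ≡⟨ cong (k *_) (sym (#-complement R)) ⟩
        k * (# R + # (not ∘ R))  ≡⟨ cong (λ z → k * (# R + z)) e ⟩
        k * (# R + 0)            ≡⟨ cong (k *_) (+-identityʳ _) ⟩
        k * # R                  ≤⟨ inv ⟩
        k + edges R              ≤⟨ +-monoʳ-≤ k (edges-mono-full R) ⟩
        k + edges (λ _ → true)   ∎
        where open ≤-Reasoning
      explore : ∀ m R → R r ≡ true → # (not ∘ R) ≡ m → k * # R ≤ k + edges R → k * n ≤ k + edges (λ _ → true)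
      explore zero R r∈R e inv = finish R e inv
      explore (suc m) R r∈R e inv with nonempty? (not ∘ R)
      ... | inj₂ e′ = finish R e′ inv
      ... | inj₁ (x , x∉R) with crossing-edge R (conn r x) r∈R (not-true x∉R)
      ...   | u , w , u∈R , w∉R , uw = explore m (R ∪ w) (r∈∪ r∈R) remaining (begin
          k * # (R ∪ w)                          ≡⟨ cong (k *_) (#-∪ R w w∉R) ⟩
          k * suc (# R)                          ≡⟨ *-suc k (# R) ⟩
          k + k * # R                            ≤⟨ +-monoʳ-≤ k inv ⟩
          k + (k + edges R)                      ≤⟨ +-monoʳ-≤ k (≤-trans (≤-reflexive (+-comm k _)) (≤-trans (+-monoʳ-≤ (edges R) (cover u w uw)) (edges-step R u w u∈R w∉R uw))) ⟩
          k + edges (R ∪ w)                      ∎)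
        where
        open ≤-Reasoning
        r∈∪ : R r ≡ true → (R ∪ w) r ≡ true
        r∈∪ h rewrite h = refl
        remaining : # (not ∘ (R ∪ w)) ≡ m
        remaining = suc-injective (+-cancelˡ-≡ (# R) _ _ (trans (+-suc (# R) _)
          (trans (cong (_+ # (not ∘ (R ∪ w))) (sym (#-∪ R w w∉R)))
          (trans (#-complement (R ∪ w)) (trans (sym (#-complement R)) (cong (# R +_) e))))))

    edges≤ : ∀ D → (∀ v → deg G (λ _ → true) v ≤ D) → edges (λ _ → true) ≤ # W * D
    edges≤ D h = ≤-trans (sum-mono {n} row) (≤-reflexive (sum-*ʳ (λ i → ⟦ W i ⟧) D))
      where
      row : ∀ i → sum (edge (λ _ → true) i) ≤ ⟦ W i ⟧ * D
      row i with W i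
      ... | true = ≤-trans (h i) (≤-reflexive (sym (+-identityʳ D)))
      ... | false = ≤-reflexive (trans (sum-full n 0) (*-zeroʳ n))

  -- The complement of a maximum stable set is a vertex cover.
  maxdeg-bound : Connected G → Fin n → ∀ c D → α G + c ≡ n → (∀ v → deg G (λ _ → true) v ≤ D) → n ≤ suc (c * D)
  maxdeg-bound conn r c D α+c h with α-attained G
  ... | M , M-stable , |M| = begin
      n                          ≡⟨ sym (+-identityʳ n) ⟩
      1 * n                      ≤⟨ spanning W 1 conn cover r ⟩
      suc (edges W (λ _ → true)) ≤⟨ s≤s (edges≤ W D h) ⟩
      suc (# W * D)              ≡⟨ cong (λ z → suc (z * D)) #W ⟩
      suc (c * D)                ∎
    where
    open ≤-Reasoning
    W : VertexSet n
    W = not ∘ lookup M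
    #W : # W ≡ c
    #W = +-cancelˡ-≡ (α G) _ _ (trans (cong (_+ # W) (trans (sym |M|) (size≡# M))) (trans (#-complement (lookup M)) (sym α+c)))
    cover : ∀ u w → adj G u w ≡ true → 1 ≤ ⟦ W u ⟧ + ⟦ W w ⟧
    cover u w uw with lookup M u in eu | lookup M w in ew
    ... | false | _ = s≤s z≤n
    ... | true | false = s≤s z≤n
    ... | true | true = ⊥-elim (true≢false uw (M-stable u w eu ew))

  -- With `W` the set of all vertices every edge counts twice, so this says that a connected graph
  -- has at least `n - 1` edges.
  degree-sum : Connected G → Fin n → 2 * n ≤ 2 + sum (deg G (λ _ → true))
  degree-sum conn r = spanning (λ _ → true) 2 conn (λ _ _ _ → ≤-refl) r

-- The lower bound on `F` and complete split graphs

_⊑_ : ∀ {n} → Vec Bool n → Vec Bool n → Set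
s ⊑ M = s ⊆ lookup M

⊑-∷ : ∀ {n a} {s M : Vec Bool n} → s ⊑ M → (a ∷ s) ⊑ (a ∷ M)
⊑-∷ h zero e = e
⊑-∷ h (suc i) e = h i e

⊑-false∷ : ∀ {n b} {s M : Vec Bool n} → s ⊑ M → (false ∷ s) ⊑ (b ∷ M)
⊑-false∷ h (suc i) e = h i e

⊑-tail : ∀ {n a b} {s M : Vec Bool n} → (a ∷ s) ⊑ (b ∷ M) → s ⊑ M
⊑-tail h i = h (suc i)

size-⊑ : ∀ {n} (s M : Vec Bool n) → s ⊑ M → size s ≤ size M
size-⊑ [] [] _ = z≤n
size-⊑ (false ∷ s) (false ∷ M) h = size-⊑ s M (⊑-tail h)
size-⊑ (false ∷ s) (true ∷ M) h = m≤n⇒m≤1+n (size-⊑ s M (⊑-tail h))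
size-⊑ (true ∷ s) (true ∷ M) h = s≤s (size-⊑ s M (⊑-tail h))
size-⊑ (true ∷ s) (false ∷ M) h with h zero refl
... | ()

2^-double : ∀ m → 2 ^ m + 2 ^ m ≡ 2 ^ suc m
2^-double m = cong (2 ^ m +_) (sym (+-identityʳ (2 ^ m)))

cnt-subsets-≥ : ∀ {n} (M : Vec Bool n) {p} → (∀ s → s ⊑ M → p s ≡ true) → 2 ^ size M ≤ cnt p
cnt-subsets-≥ [] h rewrite h [] (λ ()) = ≤-refl
cnt-subsets-≥ (false ∷ M) h = ≤-trans (cnt-subsets-≥ M (λ s s⊑M → h (false ∷ s) (⊑-∷ s⊑M))) (m≤m+n _ _)
cnt-subsets-≥ (true ∷ M) h = ≤-trans (≤-reflexive (sym (2^-double (size M))))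
  (+-mono-≤ (cnt-subsets-≥ M (λ s s⊑M → h (false ∷ s) (⊑-false∷ s⊑M)))
            (cnt-subsets-≥ M (λ s s⊑M → h (true ∷ s) (⊑-∷ s⊑M))))

cnt-subsets-≤ : ∀ {n} (M : Vec Bool n) {p} → (∀ s → p s ≡ true → s ⊑ M) → cnt p ≤ 2 ^ size M
cnt-subsets-≤ [] {p} h with p []
... | true = ≤-refl
... | false = z≤n
cnt-subsets-≤ (false ∷ M) {p} h = ≤-trans
  (+-mono-≤ (cnt-subsets-≤ M (λ s ps → ⊑-tail (h (false ∷ s) ps)))
            (≤-reflexive (cnt-none λ s → excluded s (p (true ∷ s)) refl)))
  (≤-reflexive (+-identityʳ _))
  where
  excluded : ∀ s b → p (true ∷ s) ≡ b → p (true ∷ s) ≡ false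
  excluded s false e = e
  excluded s true e with h (true ∷ s) e zero refl
  ... | ()
cnt-subsets-≤ (true ∷ M) h = ≤-trans
  (+-mono-≤ (cnt-subsets-≤ M (λ s ps → ⊑-tail (h (false ∷ s) ps)))
            (cnt-subsets-≤ M (λ s ps → ⊑-tail (h (true ∷ s) ps))))
  (≤-reflexive (2^-double (size M)))

cosize : ∀ {n} → Vec Bool n → ℕ
cosize [] = 0
cosize (false ∷ M) = suc (cosize M)
cosize (true ∷ M) = cosize M

size+cosize : ∀ {n} (M : Vec Bool n) → size M + cosize M ≡ n
size+cosize [] = refl
size+cosize (false ∷ M) = trans (+-suc (size M) _) (cong suc (size+cosize M))
size+cosize (true ∷ M) = cong suc (size+cosize M)

-- The stable sets of the split graph with stable part M and clique V ∖ M, all edges between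
-- the two parts being present: subsets of M and single vertices.
SplitStable : ∀ {n} → Vec Bool n → Vec Bool n → Set
SplitStable M s = ∀ i j → lookup s i ≡ true → lookup s j ≡ true → i ≢ j → lookup M i ≡ true

⊑⇒SplitStable : ∀ {n} {M s : Vec Bool n} → s ⊑ M → SplitStable M s
⊑⇒SplitStable h i _ i∈s _ _ = h i i∈s

SplitStable-tail : ∀ {n a b} {M s : Vec Bool n} → SplitStable (b ∷ M) (a ∷ s) → SplitStable M s
SplitStable-tail h i j i∈ j∈ i≢j = h (suc i) (suc j) i∈ j∈ λ { refl → i≢j refl }

SplitStable-true : ∀ {n b} {M s : Vec Bool n} → SplitStable (b ∷ M) (true ∷ s) → s ⊑ M
SplitStable-true h i i∈ = h (suc i) zero i∈ refl λ ()

SplitStable-false : ∀ {n b} {M s : Vec Bool n} → SplitStable M s → SplitStable (b ∷ M) (false ∷ s)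
SplitStable-false h (suc i) (suc j) i∈ j∈ i≢j = h i j i∈ j∈ λ { refl → i≢j refl }

SplitStable-false∷true : ∀ {n} {M s : Vec Bool n} → SplitStable (false ∷ M) (true ∷ s) → ∀ i → lookup s i ≡ false
SplitStable-false∷true {s = s} h i with lookup s i in eq
... | false = refl
... | true with h zero (suc i) refl eq (λ ())
...   | ()

cnt-split-≥ : ∀ {n} (M : Vec Bool n) {p} → (∀ s → SplitStable M s → p s ≡ true) → 2 ^ size M + cosize M ≤ cnt p
cnt-split-≥ [] h rewrite h [] (λ ()) = ≤-refl
cnt-split-≥ {suc n} (false ∷ M) h = begin
  2 ^ size M + suc (cosize M)     ≡⟨ trans (+-suc _ _) (+-comm 1 _) ⟩
  2 ^ size M + cosize M + 1       ≡⟨ cong (λ z → 2 ^ size M + cosize M + 2 ^ z) (sym (size-∅ n)) ⟩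
  -- The head belongs to the clique, so its singleton is the only set containing it; it is counted
  -- as the one subset of the empty set.
  2 ^ size M + cosize M + 2 ^ size (replicate n false)
    ≤⟨ +-mono-≤ (cnt-split-≥ M (λ s st → h (false ∷ s) (SplitStable-false st)))
                (cnt-subsets-≥ (replicate n false) (λ s s⊑∅ → h (true ∷ s) (alone s s⊑∅))) ⟩
  _ ∎
  where
  open ≤-Reasoning
  alone : ∀ s → s ⊑ replicate n false → SplitStable (false ∷ M) (true ∷ s)
  alone s s⊑∅ zero zero _ _ ne = ⊥-elim (ne refl)
  alone s s⊑∅ (suc i) _ i∈ _ _ = ⊥-elim (true≢false (s⊑∅ i i∈) (lookup-replicate i false))
  alone s s⊑∅ zero (suc j) _ j∈ _ = ⊥-elim (true≢false (s⊑∅ j j∈) (lookup-replicate j false))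
cnt-split-≥ (true ∷ M) h = ≤-trans
  (≤-reflexive (trans (cong (_+ cosize M) (sym (2^-double (size M))))
    (solve 2 (λ x c → x :+ x :+ c := x :+ c :+ x) refl (2 ^ size M) (cosize M))))
  (+-mono-≤ (cnt-split-≥ M (λ s st → h (false ∷ s) (SplitStable-false st)))
            (cnt-subsets-≥ M (λ s s⊑M → h (true ∷ s) (⊑⇒SplitStable {M = true ∷ M} {s = true ∷ s} (⊑-∷ s⊑M)))))

cnt-split-≤ : ∀ {n} (M : Vec Bool n) {p} → (∀ s → p s ≡ true → SplitStable M s) → cnt p ≤ 2 ^ size M + cosize M
cnt-split-≤ [] {p} h with p []
... | true = ≤-refl
... | false = z≤n
cnt-split-≤ (false ∷ M) h = ≤-trans
  (+-mono-≤ (cnt-split-≤ M (λ s ps → SplitStable-tail (h (false ∷ s) ps)))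
            (cnt≤1 (λ s ps → SplitStable-false∷true {M = M} (h (true ∷ s) ps))))
  (≤-reflexive (trans (+-comm _ 1) (sym (+-suc _ _))))
cnt-split-≤ (true ∷ M) h = ≤-trans
  (+-mono-≤ (cnt-split-≤ M (λ s ps → SplitStable-tail (h (false ∷ s) ps)))
            (cnt-subsets-≤ M (λ s ps → SplitStable-true (h (true ∷ s) ps))))
  (≤-reflexive (trans (solve 2 (λ x c → x :+ c :+ x := x :+ x :+ c) refl (2 ^ size M) (cosize M))
    (cong (_+ cosize M) (2^-double (size M)))))

-- A split stable set is a subset of `M` or a singleton; `1 ≤ size M` takes care of the singletons.
size-split-≤ : ∀ {n} (M s : Vec Bool n) → 1 ≤ size M → SplitStable M s → size s ≤ size M
size-split-≤ M s 1≤ h = ≤-trans (go M s h) (⊔-lub 1≤ ≤-refl)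
  where
  go : ∀ {n} (M s : Vec Bool n) → SplitStable M s → size s ≤ 1 ⊔ size M
  go [] [] _ = z≤n
  go (b ∷ M) (false ∷ s) h = ≤-trans (go M s (SplitStable-tail h)) (⊔-monoʳ-≤ 1 (size-∷ b))
    where
    size-∷ : ∀ b → size M ≤ size (b ∷ M)
    size-∷ false = ≤-refl
    size-∷ true = n≤1+n _
  go (true ∷ M) (true ∷ s) h = s≤s (size-⊑ s M (SplitStable-true h))
  go {suc n} (false ∷ M) (true ∷ s) h =
    ≤-trans (s≤s (≤-trans (size-⊑ s (replicate n false) empty) (≤-reflexive (size-∅ n)))) (m≤m⊔n 1 (size M))
    where
    empty : s ⊑ replicate n false
    empty i i∈ = ⊥-elim (true≢false i∈ (SplitStable-false∷true {M = M} h i))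

F-lower : ∀ {n} (G : Graph n) c → α G + c ≡ n → 2 ^ α G + c ≤ F G
F-lower {n} G c α+c with α-attained G
... | M , M-stable , |M| = begin
    2 ^ α G + c            ≡⟨ cong₂ _+_ (cong (2 ^_) (sym |M|)) (sym cosize≡c) ⟩
    2 ^ size M + cosize M  ≤⟨ cnt-split-≥ M (λ s st → Stable⇒isStable G s (stable s st)) ⟩
    cnt (isStable G)       ≡⟨ sym (F≡cnt G) ⟩
    F G                    ∎
  where
  open ≤-Reasoning
  cosize≡c : cosize M ≡ c
  cosize≡c = +-cancelˡ-≡ (α G) _ _ (trans (cong (_+ cosize M) (sym |M|)) (trans (size+cosize M) (sym α+c)))
  stable : ∀ s → SplitStable M s → Stable G s
  stable s h i j i∈ j∈ with i ≟ j
  ... | yes refl = irrefl G i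
  ... | no i≢j = M-stable i j (h i j i∈ j∈ i≢j) (h j i j∈ i∈ (i≢j ∘ sym))

Split : ∀ {n} → Vec Bool n → Graph n
Split M = record
  { adj     = λ i j → not (does (i ≟ j)) ∧ not (lookup M i ∧ lookup M j)
  ; adj-sym = λ i j → cong₂ (λ x y → not x ∧ not y) (≟-sym i j) (∧-comm (lookup M i) (lookup M j))
  ; irrefl  = λ i → cong (λ x → not x ∧ not (lookup M i ∧ lookup M i)) (≟-refl i)
  }
  where
  ≟-sym : ∀ {n} (i j : Fin n) → does (i ≟ j) ≡ does (j ≟ i)
  ≟-sym i j with i ≟ j | j ≟ i
  ... | yes _ | yes _ = refl
  ... | no _ | no _ = refl
  ... | yes i≡j | no j≢i = ⊥-elim (j≢i (sym i≡j))
  ... | no i≢j | yes j≡i = ⊥-elim (i≢j (sym j≡i))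

module _ {n : ℕ} (M : Vec Bool n) where

  Split-stable⇒ : ∀ s → Stable (Split M) s → SplitStable M s
  Split-stable⇒ s st i j i∈ j∈ i≢j with i ≟ j | st i j i∈ j∈
  ... | yes i≡j | _ = ⊥-elim (i≢j i≡j)
  ... | no _ | e with lookup M i
  ...   | true = refl

  Split-α : 1 ≤ size M → α (Split M) ≡ size M
  Split-α 1≤ = ≤-antisym upper′ (size≤α (Split M) M M-stable)
    where
    M-stable : Stable (Split M) M
    M-stable i j i∈ j∈ with i ≟ j
    ... | yes _ = refl
    ... | no _ rewrite i∈ | j∈ = refl
    upper′ : α (Split M) ≤ size M
    upper′ with α-attained (Split M)
    ... | s , st , e = subst (_≤ size M) e (size-split-≤ M s 1≤ (Split-stable⇒ s st))

  Split-F : 1 ≤ size M → F (Split M) ≡ 2 ^ size M + cosize M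
  Split-F 1≤ = ≤-antisym
    (≤-trans (≤-reflexive (F≡cnt (Split M)))
      (cnt-split-≤ M (λ s e → Split-stable⇒ s (isStable⇒Stable (Split M) s e))))
    (subst (λ a → 2 ^ a + cosize M ≤ F (Split M)) (Split-α 1≤)
      (F-lower (Split M) (cosize M) (trans (cong (_+ cosize M) (Split-α 1≤)) (size+cosize M))))

  -- A vertex outside `M` is adjacent to all others, so any two vertices are joined through `u`.
  Split-connected : ∀ u → lookup M u ≡ false → Connected (Split M)
  Split-connected u u∉M i j = to-u i (from-u j)
    where
    from-u : ∀ j → Reach (Split M) u j
    from-u j with u ≟ j in eq
    ... | yes refl = here
    ... | no _ = step u~j here
      where
      u~j : adj (Split M) u j ≡ true
      u~j rewrite eq | u∉M = refl
    to-u : ∀ i → Reach (Split M) u j → Reach (Split M) i j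
    to-u i path with u ≟ i in eq
    ... | yes refl = path
    ... | no _ = step (trans (adj-sym (Split M) i u) u~i) path
      where
      u~i : adj (Split M) u i ≡ true
      u~i rewrite eq | u∉M = refl

prefix : ∀ n → ℕ → Vec Bool n
prefix zero _ = []
prefix (suc n) zero = false ∷ prefix n zero
prefix (suc n) (suc k) = true ∷ prefix n k

size-prefix : ∀ n k → k ≤ n → size (prefix n k) ≡ k
size-prefix zero zero _ = refl
size-prefix (suc n) zero _ = size-prefix n zero z≤n
size-prefix (suc n) (suc k) (s≤s k≤n) = cong suc (size-prefix n k k≤n)

∉-prefix : ∀ n k → k < n → ∃ λ u → lookup (prefix n k) u ≡ false
∉-prefix (suc n) zero _ = zero , refl
∉-prefix (suc n) (suc k) (s≤s k<n) with ∉-prefix n k k<n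
... | u , u∉ = suc u , u∉

-- Both parts have to be nonempty: with `c = 0` the split graph has no edges, and with `k = 0` it is
-- a clique, whose stability number is 1.
vertex : ∀ n k c → k + c ≡ n → 1 ≤ k → 1 ≤ c → ∃ λ (G : Graph n) → Connected G × α G ≡ k × F G ≡ 2 ^ k + c
vertex n k c k+c 1≤k 1≤c with ∉-prefix n k k<n
  where
  k<n : k < n
  k<n = subst (k <_) k+c (m<m+n k 1≤c)
... | u , u∉ = Split M , Split-connected M u u∉ , trans (Split-α M 1≤M) |M| ,
    trans (Split-F M 1≤M) (cong₂ (λ x y → 2 ^ x + y) |M| cosize≡c)
  where
  M : Vec Bool n
  M = prefix n k
  |M| : size M ≡ k
  |M| = size-prefix n k (subst (k ≤_) k+c (m≤m+n k c))
  1≤M : 1 ≤ size M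
  1≤M = subst (1 ≤_) (sym |M|) 1≤k
  cosize≡c : cosize M ≡ c
  cosize≡c = +-cancelˡ-≡ k _ _ (trans (cong (_+ cosize M) (sym |M|)) (trans (size+cosize M) (sym k+c)))

-- Numerical estimates for the upper inequality

-- (x + 1, f) satisfies the upper inequality for order N + 2, rearranged over ℕ.
record Upper (N x f : ℕ) : Set where
  constructor mkUpper
  field
    bound : N * f + (N + 2) * x ≤ N * (N + 3) + 2 ^ (N + 1) * x

Upper-antitone : ∀ N x {f g} → f ≤ g → Upper N x g → Upper N x f
Upper-antitone N x f≤g (mkUpper h) = mkUpper (≤-trans (+-monoˡ-≤ ((N + 2) * x) (*-monoʳ-≤ N f≤g)) h)

dec≤ : ∀ m n → {T (m ≤ᵇ n)} → m ≤ n
dec≤ m n {t} = ≤ᵇ⇒≤ m n t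

2[N+1]²≤2^[N+1] : ∀ t → 2 * ((7 + t) * (7 + t)) ≤ 2 ^ (7 + t)
2[N+1]²≤2^[N+1] zero = dec≤ 98 128
2[N+1]²≤2^[N+1] (suc t) = begin
  2 * ((8 + t) * (8 + t))                          ≤⟨ m≤m+n _ (2 * (t * t + 12 * t + 34)) ⟩
  2 * ((8 + t) * (8 + t)) + 2 * (t * t + 12 * t + 34)
    ≡⟨ solve 1 (λ t → con 2 :* ((con 8 :+ t) :* (con 8 :+ t)) :+ con 2 :* (t :* t :+ con 12 :* t :+ con 34)
                    := con 2 :* (con 2 :* ((con 7 :+ t) :* (con 7 :+ t)))) refl t ⟩
  2 * (2 * ((7 + t) * (7 + t)))                    ≤⟨ *-monoʳ-≤ 2 (2[N+1]²≤2^[N+1] t) ⟩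
  2 ^ (8 + t)                                      ∎
  where open ≤-Reasoning

-- From N to N + 1 the bound grows by at least the factor 3/2.
Upper-step : ∀ t x {f g} → 1 ≤ x → 2 * g ≤ 3 * f → Upper (6 + t) x f → Upper (7 + t) x g
-- The weights `3 * (N + 1)` for the old inequality and `2 * N` for the new one give `f` and `g`
-- coefficients in the ratio 3 to 2; the summand `3 * (N + 1) * (N + 2) * x` on both sides avoids
-- subtraction.
Upper-step t x {f} {g} 1≤x 2g≤3f (mkUpper h) = mkUpper (*-cancelˡ-≤ (2 * N) (+-cancelʳ-≤ (3 * (N + 1) * (N + 2) * x) _ _ (begin
    2 * N * (suc N * g + (suc N + 2) * x) + 3 * (N + 1) * (N + 2) * x
      ≡⟨ solve 3 (λ N g x → con 2 :* N :* ((con 1 :+ N) :* g :+ (con 1 :+ N :+ con 2) :* x) :+ con 3 :* (N :+ con 1) :* (N :+ con 2) :* x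
                         := N :* (N :+ con 1) :* (con 2 :* g) :+ (con 2 :* N :* (N :+ con 3) :* x :+ con 3 :* (N :+ con 1) :* (N :+ con 2) :* x)) refl N g x ⟩
    N * (N + 1) * (2 * g) + (2 * N * (N + 3) * x + 3 * (N + 1) * (N + 2) * x)
      ≤⟨ +-monoˡ-≤ _ (*-monoʳ-≤ (N * (N + 1)) 2g≤3f) ⟩
    N * (N + 1) * (3 * f) + (2 * N * (N + 3) * x + 3 * (N + 1) * (N + 2) * x)
      ≡⟨ solve 3 (λ N f x → N :* (N :+ con 1) :* (con 3 :* f) :+ (con 2 :* N :* (N :+ con 3) :* x :+ con 3 :* (N :+ con 1) :* (N :+ con 2) :* x)
                         := con 3 :* (N :+ con 1) :* (N :* f :+ (N :+ con 2) :* x) :+ con 2 :* N :* (N :+ con 3) :* x) refl N f x ⟩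
    3 * (N + 1) * (N * f + (N + 2) * x) + 2 * N * (N + 3) * x
      ≤⟨ +-monoˡ-≤ _ (*-monoʳ-≤ (3 * (N + 1)) h) ⟩
    3 * (N + 1) * (N * (N + 3) + P * x) + 2 * N * (N + 3) * x
      ≡⟨ solve 3 (λ N P x → con 3 :* (N :+ con 1) :* (N :* (N :+ con 3) :+ P :* x) :+ con 2 :* N :* (N :+ con 3) :* x
                         := N :* ((N :+ con 1) :* (N :+ con 1)) :+ (con 2 :* N :* (N :+ con 1) :* (N :+ con 4) :+ con 3 :* (N :+ con 1) :* P :* x :+ con 2 :* N :* (N :+ con 3) :* x)) refl N P x ⟩
    N * ((N + 1) * (N + 1)) + (2 * N * (N + 1) * (N + 4) + 3 * (N + 1) * P * x + 2 * N * (N + 3) * x)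
      ≤⟨ +-monoˡ-≤ _ main ⟩
    (3 + t) * (P * x) + (2 * N * (N + 1) * (N + 4) + 3 * (N + 1) * P * x + 2 * N * (N + 3) * x)
      ≤⟨ m≤m+n _ ((N * N + 3 * N + 6) * x) ⟩
    (3 + t) * (P * x) + (2 * N * (N + 1) * (N + 4) + 3 * (N + 1) * P * x + 2 * N * (N + 3) * x) + (N * N + 3 * N + 6) * x
      ≡⟨ solve 3 (λ t P x → let N = con 6 :+ t in
           (con 3 :+ t) :* (P :* x) :+ (con 2 :* N :* (N :+ con 1) :* (N :+ con 4) :+ con 3 :* (N :+ con 1) :* P :* x :+ con 2 :* N :* (N :+ con 3) :* x) :+ (N :* N :+ con 3 :* N :+ con 6) :* x
           := con 2 :* N :* ((con 1 :+ N) :* (con 1 :+ N :+ con 3) :+ con 2 :* P :* x) :+ con 3 :* (N :+ con 1) :* (N :+ con 2) :* x) refl t P x ⟩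
    2 * N * (suc N * (suc N + 3) + 2 ^ (suc N + 1) * x) + 3 * (N + 1) * (N + 2) * x ∎)))
  where
  open ≤-Reasoning
  N = 6 + t
  P = 2 ^ (N + 1)
  -- With these weights the new side has `4 * N - 3 * (N + 1) = N - 3 = 3 + t` more copies of
  -- `P * x`, while its constant term is smaller by `N * (N + 1) * (N + 1)`. The estimate
  -- `N ≤ 2 * (N - 3)` is where `N ≥ 6` enters.
  main : N * ((N + 1) * (N + 1)) ≤ (3 + t) * (P * x)
  main = begin
    N * ((N + 1) * (N + 1))                ≤⟨ *-monoˡ-≤ ((N + 1) * (N + 1)) (m≤m+n N t) ⟩
    (N + t) * ((N + 1) * (N + 1))          ≡⟨ solve 1 (λ t → let N = con 6 :+ t in (N :+ t) :* ((N :+ con 1) :* (N :+ con 1))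
                                                := (con 3 :+ t) :* (con 2 :* ((con 7 :+ t) :* (con 7 :+ t)))) refl t ⟩
    (3 + t) * (2 * ((7 + t) * (7 + t)))    ≤⟨ *-monoʳ-≤ (3 + t) (2[N+1]²≤2^[N+1] t) ⟩
    (3 + t) * 2 ^ (7 + t)                  ≡⟨ cong (λ z → (3 + t) * 2 ^ z) (+-comm 1 N) ⟩
    (3 + t) * P                            ≡⟨ cong ((3 + t) *_) (sym (*-identityʳ P)) ⟩
    (3 + t) * (P * 1)                      ≤⟨ *-monoʳ-≤ (3 + t) (*-monoʳ-≤ P 1≤x) ⟩
    (3 + t) * (P * x)                      ∎

turánValue : ℕ → ℕ → ℕ → ℕ
turánValue q r s = suc q ^ s * suc (suc q) ^ r

-- v is the number of stable sets of a disjoint union of a cliques of orders at least 1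
-- which differ by at most 1 and add up to at least m.
TuránBound : ℕ → ℕ → ℕ → Set
TuránBound a m v = ∃ λ q → ∃₂ λ r s → r + s ≡ a × m ≤ suc q * (r + s) + r × v ≡ turánValue (suc q) r s

3/2-growth : ∀ q y → 2 * ((3 + q) * y) ≤ 3 * ((2 + q) * y)
3/2-growth q y = ≤-trans (m≤m+n _ (q * y)) (≤-reflexive
  (solve 2 (λ q y → con 2 :* ((con 3 :+ q) :* y) :+ q :* y := con 3 :* ((con 2 :+ q) :* y)) refl q y))

-- The extra vertex goes to a smallest clique. Its order `p` is at least 1, so the value grows by
-- `(p + 2) / (p + 1) ≤ 3/2`; a clique of order 0 would double it, hence the `suc q` in
-- `TuránBound`.
turán-advance : ∀ {a m v} → TuránBound (suc a) m v → ∃ λ v′ → TuránBound (suc a) (suc m) v′ × 2 * v′ ≤ 3 * v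
turán-advance {a} {m} (q , r , suc s , r+s , m≤ , refl) =
  _ , (q , suc r , s , trans (sym (+-suc r s)) r+s , cap , refl) , growth
  where
  cap : suc m ≤ suc q * (suc r + s) + suc r
  cap = ≤-trans (s≤s m≤) (≤-reflexive (solve 3 (λ q r s → con 1 :+ ((con 1 :+ q) :* (r :+ (con 1 :+ s)) :+ r)
    := (con 1 :+ q) :* (con 1 :+ r :+ s) :+ (con 1 :+ r)) refl q r s))
  growth : 2 * turánValue (suc q) (suc r) s ≤ 3 * turánValue (suc q) r (suc s)
  growth = ≤-trans (≤-reflexive (cong (2 *_) (solve 3 (λ x k y → x :* (k :* y) := k :* (x :* y)) refl ((2 + q) ^ s) (3 + q) ((3 + q) ^ r))))
    (≤-trans (3/2-growth q ((2 + q) ^ s * (3 + q) ^ r))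
      (≤-reflexive (cong (3 *_) (sym (*-assoc (2 + q) ((2 + q) ^ s) ((3 + q) ^ r))))))
-- All cliques have the same order `q + 2`, so the enlarged one opens the next level.
turán-advance {a} {m} (q , suc r , zero , r+s , m≤ , refl) =
  _ , (suc q , 1 , r , trans (cong suc (sym (+-identityʳ r))) r+s , cap , refl) , growth
  where
  cap : suc m ≤ suc (suc q) * (1 + r) + 1
  cap = ≤-trans (s≤s m≤) (≤-reflexive (solve 2 (λ q r → con 1 :+ ((con 1 :+ q) :* (con 1 :+ r :+ con 0) :+ (con 1 :+ r))
    := (con 2 :+ q) :* (con 1 :+ r) :+ con 1) refl q r))
  growth : 2 * turánValue (suc (suc q)) 1 r ≤ 3 * turánValue (suc q) (suc r) zero
  growth = ≤-trans (≤-reflexive (cong (2 *_) (solve 2 (λ x k → x :* (k :* con 1) := k :* x) refl ((3 + q) ^ r) (4 + q))))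
    (≤-trans (3/2-growth (suc q) ((3 + q) ^ r))
      (≤-reflexive (cong (3 *_) (sym (*-identityˡ ((3 + q) * (3 + q) ^ r))))))

-- The upper inequality for order N + 3 holds after branching at a vertex of degree 2.
DegreeTwo : ℕ → ℕ → Set
DegreeTwo N x = ∃₂ λ b c → TuránBound (suc x) (2 + N) b × TuránBound x N c × Upper (suc N) x (b + c)

degreeTwo-step : ∀ t x → DegreeTwo (5 + t) (suc x) → DegreeTwo (6 + t) (suc x)
degreeTwo-step t x (b , c , tb , tc , h) with turán-advance tb | turán-advance tc
... | b′ , tb′ , 2b′≤ | c′ , tc′ , 2c′≤ = b′ , c′ , tb′ , tc′ , Upper-step t (suc x) {b + c} {b′ + c′} (s≤s z≤n) 2≤ h
  where
  2≤ : 2 * (b′ + c′) ≤ 3 * (b + c)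
  2≤ = ≤-trans (≤-reflexive (*-distribˡ-+ 2 b′ c′)) (≤-trans (+-mono-≤ 2b′≤ 2c′≤) (≤-reflexive (sym (*-distribˡ-+ 3 b c))))

degreeTwo-from : ∀ t₀ x → DegreeTwo (5 + t₀) (suc x) → ∀ t → DegreeTwo (5 + (t + t₀)) (suc x)
degreeTwo-from t₀ x base zero = base
degreeTwo-from t₀ x base (suc t) = degreeTwo-step (t + t₀) x (degreeTwo-from t₀ x base t)

-- The suffix is the stability number `α`. Each base case is the least order `n ≥ 8` with
-- `α ≤ n - 3` that is not special: 8, 8, 9, 9, 10 for `α` from 2 to 6. The witnesses are balanced
-- partitions of `n - 1` vertices into `α` cliques and of `n - 3` into `α - 1`; a triple
-- `(q , r , s)` means `r` cliques of order `q + 2` and `s` of order `q + 1`.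
degreeTwo-2 : ∀ t → DegreeTwo (5 + (t + 0)) 1
degreeTwo-2 = degreeTwo-from 0 0 (_ , _ , (2 , 1 , 1 , refl , ≤-refl , refl) , (4 , 0 , 1 , refl , ≤-refl , refl) , mkUpper (dec≤ 164 182))

degreeTwo-3 : ∀ t → DegreeTwo (5 + (t + 0)) 2
degreeTwo-3 = degreeTwo-from 0 1 (_ , _ , (1 , 1 , 2 , refl , ≤-refl , refl) , (1 , 1 , 1 , refl , ≤-refl , refl) , mkUpper (dec≤ 304 310))

degreeTwo-4 : ∀ t → DegreeTwo (5 + (t + 1)) 3
degreeTwo-4 = degreeTwo-from 1 2 (_ , _ , (1 , 0 , 4 , refl , ≤-refl , refl) , (1 , 0 , 3 , refl , ≤-refl , refl) , mkUpper (dec≤ 783 838))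

degreeTwo-5 : ∀ t → DegreeTwo (5 + (t + 1)) 4
degreeTwo-5 = degreeTwo-from 1 3 (_ , _ , (0 , 3 , 2 , refl , ≤-refl , refl) , (0 , 2 , 2 , refl , ≤-refl , refl) , mkUpper (dec≤ 1044 1094))

degreeTwo-6 : ∀ t → DegreeTwo (5 + (t + 2)) 5
degreeTwo-6 = degreeTwo-from 2 4 (_ , _ , (0 , 3 , 3 , refl , ≤-refl , refl) , (0 , 2 , 3 , refl , ≤-refl , refl) , mkUpper (dec≤ 2354 2648))

-- Here the base order is `α + 3` with `α = 7 + y`, for all `y` at once. At `y = 0` the coefficients
-- of `P` on the two sides agree, `8 * 12 = 16 * 6`; for smaller `α` this uniform estimate breaks
-- down.
degreeTwo-≥7 : ∀ y t → DegreeTwo (5 + (t + (2 + y))) (6 + y)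
degreeTwo-≥7 y = degreeTwo-from (2 + y) (5 + y)
  (_ , _ , (0 , 2 , 5 + y , refl , cap₁ , refl) , (0 , 1 , 5 + y , refl , cap₂ , refl) , bound)
  where
  cap₁ : 9 + y ≤ 1 * (7 + y) + 2
  cap₁ = ≤-reflexive (solve 1 (λ y → con 9 :+ y := con 1 :* (con 7 :+ y) :+ con 2) refl y)
  cap₂ : 7 + y ≤ 1 * (6 + y) + 1
  cap₂ = ≤-reflexive (solve 1 (λ y → con 7 :+ y := con 1 :* (con 6 :+ y) :+ con 1) refl y)
  P = 2 ^ (5 + y)
  bound : Upper (8 + y) (6 + y) (P * 9 + P * 3)
  bound = mkUpper (begin
    (8 + y) * (P * 9 + P * 3) + (8 + y + 2) * (6 + y)
      ≤⟨ m≤m+n _ (3 * y + 28 + 4 * (y * P)) ⟩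
    (8 + y) * (P * 9 + P * 3) + (8 + y + 2) * (6 + y) + (3 * y + 28 + 4 * (y * P))
      ≡⟨ solve 2 (λ y P → (con 8 :+ y) :* (P :* con 9 :+ P :* con 3) :+ (con 8 :+ y :+ con 2) :* (con 6 :+ y) :+ (con 3 :* y :+ con 28 :+ con 4 :* (y :* P))
           := (con 8 :+ y) :* (con 8 :+ y :+ con 3) :+ con 16 :* P :* (con 6 :+ y)) refl y P ⟩
    (8 + y) * (8 + y + 3) + 16 * P * (6 + y)
      ≡⟨ cong (λ z → (8 + y) * (8 + y + 3) + z * (6 + y)) (sym 16P) ⟩
    (8 + y) * (8 + y + 3) + 2 ^ (8 + y + 1) * (6 + y) ∎)
    where
    open ≤-Reasoning
    16P : 2 ^ (8 + y + 1) ≡ 16 * P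
    16P = trans (cong (2 ^_) (solve 1 (λ y → con 8 :+ y :+ con 1 := con 4 :+ (con 5 :+ y)) refl y)) (^-distribˡ-+-* 2 4 (5 + y))

-- The upper inequality for connected graphs

module _ {n : ℕ} (G : Graph n) where

  V : VertexSet n
  V _ = true

  F≤-V : ∀ {b} → F≤ G V b → F G ≤ b
  F≤-V h = ≤-trans (≤-reflexive (F≡cnt G)) (h (isStable G) (λ s e → isStable⇒Stable G s e , λ _ _ → refl))

  α≤-V : ∀ {a} → α G ≡ a → α≤ G V a
  α≤-V refl s st _ = size≤α G s st

  #V≤ : ∀ {m} → n ≤ m → # V ≤ m
  #V≤ n≤m = ≤-trans (≤-reflexive (#-full n)) n≤m

  -- The unprimed parameters describe the cliques for `S ∖ v`, the primed ones those for `S ∖N v`,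
  -- which has at least `d` vertices fewer and stability number smaller by one.
  turán-branch : ∀ q r s q′ r′ s′ {S v a} d m → S v ≡ true → d ≤ deg G S v → # S ≤ suc m →
    r + s ≡ suc a → r′ + s′ ≡ a → m ≤ q * (r + s) + r → m ≤ d + (q′ * (r′ + s′) + r′) →
    α≤ G S (suc a) → F≤ G S (turánValue q r s + turánValue q′ r′ s′)
  turán-branch q r s q′ r′ s′ {S} {v} {a} d m v∈S d≤ #S≤ r+s r′+s′ cap cap′ h =
    F≤-branch G {v = v}
      (turán G q r s (S ∖ v) (≤-trans #₁ cap) (subst (α≤ G (S ∖ v)) (sym r+s) (α≤-∖ G {S} {v} h)))
      (turán G q′ r′ s′ (_∖N_ G S v) #₂ (subst (α≤ G (_∖N_ G S v)) (sym r′+s′) (α≤-∖N G v∈S h)))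
    where
    open ≤-Reasoning
    #₁ : # (S ∖ v) ≤ m
    #₁ = s≤s⁻¹ (≤-trans (≤-reflexive (#-∖ G S v v∈S)) #S≤)
    #₂ : # (_∖N_ G S v) ≤ q′ * (r′ + s′) + r′
    #₂ = +-cancelˡ-≤ d _ _ (begin
      d + # (_∖N_ G S v)           ≤⟨ +-monoˡ-≤ _ d≤ ⟩
      deg G S v + # (_∖N_ G S v)   ≤⟨ s≤s⁻¹ (≤-trans (≤-reflexive (#-∖N G S v v∈S)) #S≤) ⟩
      m                            ≤⟨ cap′ ⟩
      d + (q′ * (r′ + s′) + r′)    ∎)

  deg≤n : ∀ v → deg G V v ≤ n
  deg≤n v = ≤-trans (sum-mono {n} (λ i → ⟦⟧≤1 (adj G v i))) (≤-reflexive (#-full n))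
    where
    ⟦⟧≤1 : ∀ b → ⟦ b ⟧ ≤ 1
    ⟦⟧≤1 true = ≤-refl
    ⟦⟧≤1 false = z≤n

  1≤α : Fin n → 1 ≤ α G
  1≤α v with α G in eq
  ... | suc _ = s≤s z≤n
  ... | zero = ⊥-elim (n≮0 (≤-trans (toℕ<n v) (subst (_≤ 0) (#-full n) (greedy G (suc n) 0 V (λ u _ → s≤s (deg≤n u)) (α≤-V eq)))))

  α≤n : α G ≤ n
  α≤n with α-attained G
  ... | M , _ , e = subst (_≤ n) e (≤-trans (m≤m+n (size M) (cosize M)) (≤-reflexive (size+cosize M)))

  exists-degree : Connected G → Fin n → ∀ c d → α G + c ≡ n → suc (c * d) < n → ∃ λ v → suc d ≤ deg G V v
  exists-degree conn r c d α+c lt with large-degree? G V (suc d)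
  ... | inj₁ (v , _ , h) = v , h
  ... | inj₂ small = ⊥-elim (<⇒≱ lt (maxdeg-bound G conn r c d α+c (λ v → s≤s⁻¹ (small v refl))))

  1≤n-α : Connected G → Fin n → 1 < n → ∀ c → α G + c ≡ n → 1 ≤ c
  1≤n-α conn r 1<n (suc c) _ = s≤s z≤n
  -- If all vertices formed a stable set, the empty set would cover the edges of a connected graph
  -- of order at least 2.
  1≤n-α conn r 1<n zero α+c = ⊥-elim (<⇒≱ 1<n (maxdeg-bound G conn r 0 n α+c deg≤n))

-- The cases (n , α) = (8 , 4), (8 , 5), (9 , 6), with N = n - 3 and x = α - 1, in which branching
-- at one vertex of degree 2 is not enough.
data Special : ℕ → ℕ → Set where
  ⟨8,4⟩ : Special 5 3
  ⟨8,5⟩ : Special 5 4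
  ⟨9,6⟩ : Special 6 5

-- With `n = 8 + t` and `x = α - 1`, the number `c` is `n - 1 - α`, so `2 ≤ c` means `α ≤ n - 3`.
classify : ∀ t x c → 6 + t ≡ x + c → 1 ≤ x → 2 ≤ c → DegreeTwo (5 + t) x ⊎ Special (5 + t) x
classify t 1 _ _ _ _ = inj₁ (subst (λ z → DegreeTwo (5 + z) 1) (+-identityʳ t) (degreeTwo-2 t))
classify t 2 _ _ _ _ = inj₁ (subst (λ z → DegreeTwo (5 + z) 2) (+-identityʳ t) (degreeTwo-3 t))
classify 0 3 _ _ _ _ = inj₂ ⟨8,4⟩
classify (suc t) 3 _ _ _ _ = inj₁ (subst (λ z → DegreeTwo (5 + z) 3) (+-comm t 1) (degreeTwo-4 t))
classify 0 4 _ _ _ _ = inj₂ ⟨8,5⟩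
classify (suc t) 4 _ _ _ _ = inj₁ (subst (λ z → DegreeTwo (5 + z) 4) (+-comm t 1) (degreeTwo-5 t))
classify 0 5 1 _ _ (s≤s ())
classify 0 5 (suc (suc _)) () _ _
classify 1 5 _ _ _ _ = inj₂ ⟨9,6⟩
classify (suc (suc t)) 5 _ _ _ _ = inj₁ (subst (λ z → DegreeTwo (5 + z) 5) (+-comm t 2) (degreeTwo-6 t))
classify t (suc (suc (suc (suc (suc (suc y)))))) 1 _ _ (s≤s ())
classify t (suc (suc (suc (suc (suc (suc y)))))) (suc (suc u)) e _ _ =
  inj₁ (subst (λ z → DegreeTwo z (6 + y)) eq (degreeTwo-≥7 y u))
  where
  eq : 5 + (u + (2 + y)) ≡ 5 + t
  eq = suc-injective (trans (solve 2 (λ u y → con 6 :+ (u :+ (con 2 :+ y)) := con 6 :+ y :+ (con 2 :+ u)) refl u y) (sym e))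

module _ {N : ℕ} (G : Graph (2 + N)) (conn : Connected G) where

  -- Turán's bound with one clique is `n + 1`, and the inequality is an equality there.
  upper-clique : α G ≡ 1 → Upper N 0 (F G)
  upper-clique α≡1 = Upper-antitone N 0 {F G} {3 + N} F≤n+1 (mkUpper (≤-reflexive
      (solve 1 (λ N → N :* (con 3 :+ N) :+ (N :+ con 2) :* con 0 := N :* (N :+ con 3) :+ con 0) refl N ⟨ trans ⟩ cong (N * (N + 3) +_) (sym (*-zeroʳ (2 ^ (N + 1)))))))
    where
    F≤n+1 : F G ≤ 3 + N
    F≤n+1 = F≤-V G (F≤-weaken G (≤-reflexive (trans (*-identityʳ _) (*-identityʳ (3 + N))))
      (turán G (2 + N) 0 1 (V G) (#V≤ G (≤-reflexive (solve 1 (λ n → n := n :* con 1 :+ con 0) refl (2 + N)))) (α≤-V G α≡1)))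

  -- One vertex covers all edges, which forces a degree of `n - 1`. Branching leaves `n - 1` cliques
  -- of order 1 and, in the second branch, only cliques of order 0; the resulting `2 ^ (n - 1) + 1`
  -- meets the bound exactly.
  upper-star : α G ≡ suc N → Upper N N (F G)
  upper-star α≡ with exists-degree G conn zero 1 N (trans (+-comm (α G) 1) (cong suc α≡)) (s≤s (s≤s (≤-reflexive (+-identityʳ N))))
  ... | v , d≤ = Upper-antitone N N F≤star (mkUpper (≤-reflexive
      (trans (cong (λ z → N * (z + 1) + (N + 2) * N) (cong (2 ^_) (+-comm 1 N)))
        (solve 2 (λ N P → N :* (P :+ con 1) :+ (N :+ con 2) :* N := N :* (N :+ con 3) :+ P :* N) refl N (2 ^ (N + 1))))))
    where
    F≤star : F G ≤ 2 ^ suc N + 1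
    F≤star = F≤-V G (F≤-weaken G (≤-reflexive (cong₂ _+_ (*-identityʳ (2 ^ suc N)) (trans (*-identityʳ (1 ^ N)) (^-zeroˡ N))))
      (turán-branch G 1 0 (suc N) 0 0 N (suc N) (suc N) refl d≤ (#V≤ G ≤-refl) refl refl
        (≤-reflexive (solve 1 (λ N → con 1 :+ N := con 1 :* (con 1 :+ N) :+ con 0) refl N)) (m≤m+n (suc N) _) (α≤-V G α≡)))

-- Two vertices cover at least 7 edges, so some degree is at least 4 and the branches give `12 * P`
-- and `P`. Degree 3 would only give `14 * P`, which is too much for `n = 8`.
upper-two-cover : ∀ t (G : Graph (8 + t)) → Connected G → α G ≡ 6 + t → Upper (6 + t) (5 + t) (F G)
upper-two-cover t G conn α≡ with exists-degree G conn zero 2 3 (trans (+-comm (α G) 2) (cong (2 +_) α≡)) (dec≤ 8 8 ⟨ ≤-trans ⟩ m≤m+n 8 t)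
... | v , d≤ = Upper-antitone (6 + t) (5 + t) F≤13 bound
  where
  P = 2 ^ (3 + t)
  F≤13 : F G ≤ 13 * P
  F≤13 = F≤-V G (F≤-weaken G (≤-reflexive value)
    (turán-branch G 1 1 (5 + t) 0 (3 + t) 2 4 (7 + t) refl d≤ (#V≤ G ≤-refl) refl (+-comm (3 + t) 2)
      (≤-reflexive (solve 1 (λ t → con 7 :+ t := con 1 :* (con 6 :+ t) :+ con 1) refl t)) ≤-refl (α≤-V G α≡)))
    where
    value : 2 ^ (5 + t) * 3 + 1 * P ≡ 13 * P
    value = solve 1 (λ P → (con 2 :* (con 2 :* P)) :* con 3 :+ con 1 :* P := con 13 :* P) refl P
  bound : Upper (6 + t) (5 + t) (13 * P)
  bound = mkUpper (begin
    (6 + t) * (13 * P) + (6 + t + 2) * (5 + t)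
      ≤⟨ m≤m+n _ (14 + 2 * t + (2 + 3 * t) * P) ⟩
    (6 + t) * (13 * P) + (6 + t + 2) * (5 + t) + (14 + 2 * t + (2 + 3 * t) * P)
      ≡⟨ solve 2 (λ t P → (con 6 :+ t) :* (con 13 :* P) :+ (con 6 :+ t :+ con 2) :* (con 5 :+ t) :+ (con 14 :+ con 2 :* t :+ (con 2 :+ con 3 :* t) :* P)
           := (con 6 :+ t) :* (con 6 :+ t :+ con 3) :+ (con 16 :* P) :* (con 5 :+ t)) refl t P ⟩
    (6 + t) * (6 + t + 3) + (16 * P) * (5 + t)
      ≡⟨ cong (λ z → (6 + t) * (6 + t + 3) + z * (5 + t)) (sym 16P) ⟩
    (6 + t) * (6 + t + 3) + 2 ^ (6 + t + 1) * (5 + t) ∎)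
    where
    open ≤-Reasoning
    16P : 2 ^ (6 + t + 1) ≡ 16 * P
    16P = trans (cong (2 ^_) (+-comm (6 + t) 1)) (^-distribˡ-+-* 2 4 (3 + t))

upper-degreeTwo : ∀ N x {v} (G : Graph (3 + N)) → DegreeTwo N x → α G ≡ suc x → 2 ≤ deg G (V G) v → Upper (suc N) x (F G)
upper-degreeTwo N x G (_ , _ , (q , r , s , r+s , cap , refl) , (q′ , r′ , s′ , r′+s′ , cap′ , refl) , h) α≡ d≤ =
  Upper-antitone (suc N) x
    (F≤-V G (turán-branch G (suc q) r s (suc q′) r′ s′ 2 (2 + N) refl d≤ (#V≤ G ≤-refl) r+s r′+s′ cap (s≤s (s≤s cap′)) (α≤-V G α≡)))
    h

-- Three vertices cover at least 7 edges, so some degree is at least 3, and the branches give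
-- `72 + 16`. The same argument for `(9 , 6)` gives `144 + 32`.
upper-8-5 : (G : Graph 8) → Connected G → α G ≡ 5 → Upper 6 4 (F G)
upper-8-5 G conn α≡ with exists-degree G conn zero 3 2 (cong (_+ 3) α≡) ≤-refl
... | v , d≤ = Upper-antitone 6 4
  (F≤-V G (turán-branch G 1 2 3 1 0 4 3 7 refl d≤ (#V≤ G ≤-refl) refl refl ≤-refl ≤-refl (α≤-V G α≡))) (mkUpper (dec≤ 560 566))

upper-9-6 : (G : Graph 9) → Connected G → α G ≡ 6 → Upper 7 5 (F G)
upper-9-6 G conn α≡ with exists-degree G conn zero 3 2 (cong (_+ 3) α≡) (dec≤ 8 9)
... | v , d≤ = Upper-antitone 7 5
  (F≤-V G (turán-branch G 1 2 4 1 0 5 3 8 refl d≤ (#V≤ G ≤-refl) refl refl ≤-refl ≤-refl (α≤-V G α≡))) (mkUpper (dec≤ 1277 1350))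

-- Four covering vertices force only degree 2, whose bound `54 + 18` is too large. A vertex of
-- degree 3 gives `54 + 12`. Otherwise a second branching, at a vertex `u` of degree 2 in `G - v`,
-- replaces 54 by `36 + 12`, and the total is again 66.
upper-8-4 : (G : Graph 8) → Connected G → α G ≡ 4 → Upper 6 3 (F G)
upper-8-4 G conn α≡ with large-degree? G (V G) 3
... | inj₁ (v , _ , d≤) = Upper-antitone 6 3
  (F≤-V G (turán-branch G 1 3 1 1 1 2 3 7 refl d≤ (#V≤ G ≤-refl) refl refl ≤-refl ≤-refl (α≤-V G α≡))) (mkUpper (dec≤ 420 438))
... | inj₂ deg<3 with exists-degree G conn zero 4 1 (cong (_+ 4) α≡) (dec≤ 6 8)
...   | v , d≤ with large-degree? G (V G ∖ v) 2
...     | inj₁ (u , u∈ , e≤) = Upper-antitone 6 3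
  (F≤-V G (F≤-branch G {v = v}
    (turán-branch G 1 2 2 1 1 2 2 6 u∈ e≤ (s≤s⁻¹ #∖) refl refl ≤-refl ≤-refl (α≤-∖ G {V G} {v} (α≤-V G α≡)))
    (turán G 1 2 1 (_∖N_ G (V G) v) (+-cancelˡ-≤ 3 _ _ #∖N) (α≤-∖N G refl (α≤-V G α≡)))))
  (mkUpper (dec≤ 420 438))
  where
  #∖ : suc (# (V G ∖ v)) ≤ 8
  #∖ = ≤-reflexive (#-∖ G (V G) v refl)
  #∖N : 3 + # (_∖N_ G (V G) v) ≤ 8
  #∖N = ≤-trans (s≤s (+-monoˡ-≤ _ d≤)) (≤-reflexive (#-∖N G (V G) v refl))
-- Now every vertex other than `v` has at most one neighbour besides `v`, so the degrees add up to
-- at most 11, whereas connectivity requires `2 * 7`.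
...     | inj₂ deg<2 = ⊥-elim (<⇒≱ (dec≤ 14 16) (≤-trans (degree-sum G conn zero) (s≤s (s≤s total))))
  where
  open ≤-Reasoning
  deg≤ : ∀ u → deg G (V G) u ≤ deg G (V G ∖ v) u + ⟦ adj G v u ⟧
  deg≤ u = ≤-trans (sum-mono {8} pointwise) (≤-reflexive
    (trans (∑-distrib-+ (λ i → ⟦ (V G ∖ v) i ∧ adj G u i ⟧) (λ i → ⟦ adj G i u ⟧ * ⟦ does (i ≟ v) ⟧))
      (cong (deg G (V G ∖ v) u +_) (sum-δ v (λ i → ⟦ adj G i u ⟧)))))
    where
    pointwise : ∀ i → ⟦ adj G u i ⟧ ≤ ⟦ (V G ∖ v) i ∧ adj G u i ⟧ + ⟦ adj G i u ⟧ * ⟦ does (i ≟ v) ⟧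
    pointwise i rewrite adj-sym G i u with i ≟ v
    ... | yes _ = ≤-reflexive (sym (*-identityʳ _))
    ... | no _ = m≤m+n _ _
  vertexwise : ∀ u → deg G (V G) u ≤ 1 + (⟦ does (u ≟ v) ⟧ + ⟦ adj G v u ⟧)
  vertexwise u with u ≟ v | deg<2 u
  ... | yes refl | _ = ≤-trans (s≤s⁻¹ (deg<3 u refl)) (s≤s (s≤s z≤n))
  ... | no _ | small = ≤-trans (deg≤ u) (+-monoˡ-≤ _ (s≤s⁻¹ (small refl)))
  total : sum (deg G (V G)) ≤ 11
  total = begin
    sum (deg G (V G))
      ≤⟨ sum-mono {8} vertexwise ⟩
    sum (λ u → 1 + (⟦ does (u ≟ v) ⟧ + ⟦ adj G v u ⟧))
      ≡⟨ ∑-distrib-+ (λ (_ : Fin 8) → 1) (λ u → ⟦ does (u ≟ v) ⟧ + ⟦ adj G v u ⟧) ⟩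
    8 + sum (λ u → ⟦ does (u ≟ v) ⟧ + ⟦ adj G v u ⟧)
      ≡⟨ cong (8 +_) (∑-distrib-+ (λ u → ⟦ does (u ≟ v) ⟧) (λ u → ⟦ adj G v u ⟧)) ⟩
    8 + (# (λ u → does (u ≟ v)) + deg G (V G) v)
      ≡⟨ cong (λ z → 8 + (z + deg G (V G) v)) (#-singleton v) ⟩
    9 + deg G (V G) v
      ≤⟨ +-monoʳ-≤ 9 (s≤s⁻¹ (deg<3 v refl)) ⟩
    11 ∎

upper-bound : ∀ t (G : Graph (8 + t)) → Connected G → ∀ x c → α G ≡ suc x → 6 + t ≡ x + c → Upper (6 + t) x (F G)
upper-bound t G conn zero c α≡ _ = upper-clique G conn α≡
upper-bound t G conn x@(suc _) 0 α≡ e with trans e (+-identityʳ x)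
... | refl = upper-star G conn α≡
upper-bound t G conn (suc y) 1 α≡ e
  with trans (+-comm 1 y) (sym (suc-injective e))
... | refl = upper-two-cover t G conn α≡
upper-bound t G conn x@(suc y) (suc (suc c)) α≡ e with classify t x (suc (suc c)) e (s≤s z≤n) (s≤s (s≤s z≤n))
... | inj₂ ⟨8,4⟩ = upper-8-4 G conn α≡
... | inj₂ ⟨8,5⟩ = upper-8-5 G conn α≡
... | inj₂ ⟨9,6⟩ = upper-9-6 G conn α≡
... | inj₁ two with exists-degree G conn zero (3 + c) 1 α+c (s≤s (s≤s bound))
  where
  α+c : α G + (3 + c) ≡ 8 + t
  α+c = trans (cong (_+ (3 + c)) α≡) (trans (+-suc (suc x) (2 + c)) (cong (2 +_) (sym e)))
  bound : (3 + c) * 1 ≤ 6 + t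
  bound = ≤-trans (≤-reflexive (*-identityʳ (3 + c))) (≤-trans (s≤s (m≤n+m (2 + c) y)) (≤-reflexive (sym e)))
...   | v , d≤ = upper-degreeTwo (5 + t) x G two α≡ d≤

-- Integers inside the rationals

open import Data.Integer using (+_)

-- The division by 1 in `ℤ→ℚ` normalises through a gcd; among unnormalised rationals it becomes a
-- plain fraction with denominator 1.
toℚᵘ-ℤ→ℚ : ∀ z → toℚᵘ (ℤ→ℚ z) ℚᵘ.≃ ℚᵘ.mkℚᵘ z 0
toℚᵘ-ℤ→ℚ z = ℚ.toℚᵘ-fromℚᵘ (ℚᵘ.mkℚᵘ z 0)

ℤ→ℚ-+ : ∀ a b → ℤ→ℚ (a ℤ.+ b) ≡ ℤ→ℚ a +ℚ ℤ→ℚ b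
ℤ→ℚ-+ a b = ℚ.toℚᵘ-injective (begin
  toℚᵘ (ℤ→ℚ (a ℤ.+ b))                ≈⟨ toℚᵘ-ℤ→ℚ (a ℤ.+ b) ⟩
  ℚᵘ.mkℚᵘ (a ℤ.+ b) 0                 ≈⟨ ℚᵘ.*≡* (ℤS.solve 2 (λ a b → (a ℤS.:+ b) ℤS.:* ℤS.con 1ℤ ℤS.:= (a ℤS.:* ℤS.con 1ℤ ℤS.:+ b ℤS.:* ℤS.con 1ℤ) ℤS.:* ℤS.con 1ℤ) refl a b) ⟩
  ℚᵘ.mkℚᵘ a 0 ℚᵘ.+ ℚᵘ.mkℚᵘ b 0        ≈⟨ ℚᵘ.+-cong (ℚᵘ.≃-sym (toℚᵘ-ℤ→ℚ a)) (ℚᵘ.≃-sym (toℚᵘ-ℤ→ℚ b)) ⟩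
  toℚᵘ (ℤ→ℚ a) ℚᵘ.+ toℚᵘ (ℤ→ℚ b)      ≈⟨ ℚᵘ.≃-sym (ℚ.toℚᵘ-homo-+ (ℤ→ℚ a) (ℤ→ℚ b)) ⟩
  toℚᵘ (ℤ→ℚ a +ℚ ℤ→ℚ b)               ∎)
  where open ℚᵘ.≃-Reasoning

ℤ→ℚ-* : ∀ a b → ℤ→ℚ (a ℤ.* b) ≡ ℤ→ℚ a *ℚ ℤ→ℚ b
ℤ→ℚ-* a b = ℚ.toℚᵘ-injective (begin
  toℚᵘ (ℤ→ℚ (a ℤ.* b))                ≈⟨ toℚᵘ-ℤ→ℚ (a ℤ.* b) ⟩
  ℚᵘ.mkℚᵘ a 0 ℚᵘ.* ℚᵘ.mkℚᵘ b 0        ≈⟨ ℚᵘ.*-cong (ℚᵘ.≃-sym (toℚᵘ-ℤ→ℚ a)) (ℚᵘ.≃-sym (toℚᵘ-ℤ→ℚ b)) ⟩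
  toℚᵘ (ℤ→ℚ a) ℚᵘ.* toℚᵘ (ℤ→ℚ b)      ≈⟨ ℚᵘ.≃-sym (ℚ.toℚᵘ-homo-* (ℤ→ℚ a) (ℤ→ℚ b)) ⟩
  toℚᵘ (ℤ→ℚ a *ℚ ℤ→ℚ b)               ∎)
  where open ℚᵘ.≃-Reasoning

ℤ→ℚ-mono-≤ : ∀ {a b} → a ℤ.≤ b → ℤ→ℚ a ≤ℚ ℤ→ℚ b
ℤ→ℚ-mono-≤ {a} {b} a≤b = ℚ.toℚᵘ-cancel-≤ (begin
  toℚᵘ (ℤ→ℚ a)  ≃⟨ toℚᵘ-ℤ→ℚ a ⟩
  ℚᵘ.mkℚᵘ a 0   ≤⟨ ℚᵘ.*≤* (ℤ.*-monoʳ-≤-nonNeg 1ℤ a≤b) ⟩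
  ℚᵘ.mkℚᵘ b 0   ≃⟨ ℚᵘ.≃-sym (toℚᵘ-ℤ→ℚ b) ⟩
  toℚᵘ (ℤ→ℚ b)  ∎)
  where open ℚᵘ.≤-Reasoning

ℤ→ℚ-injective : ∀ {a b} → ℤ→ℚ a ≡ ℤ→ℚ b → a ≡ b
ℤ→ℚ-injective {a} {b} e with ℚᵘ.≃-trans (ℚᵘ.≃-sym (toℚᵘ-ℤ→ℚ a)) (ℚᵘ.≃-trans (ℚᵘ.≃-reflexive (cong toℚᵘ e)) (toℚᵘ-ℤ→ℚ b))
... | ℚᵘ.*≡* h = ℤ.*-cancelʳ-≡ a b 1ℤ h

ℤ→ℚ-1 : ∀ a → ℤ→ℚ (a ℤ.- 1ℤ) ≡ ℤ→ℚ a -ℚ 1ℚ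
ℤ→ℚ-1 a = ℤ→ℚ-+ a (ℤ.- 1ℤ)

ℤ→ℚ-positive : ∀ m → Positive (ℕ→ℚ (suc m))
ℤ→ℚ-positive m = ℚ.positive (ℚ.<-≤-trans (ℚ.positive⁻¹ 1ℚ) (ℤ→ℚ-mono-≤ {1ℤ} {+ suc m} (ℤ.+≤+ (s≤s z≤n))))

-- An inequality depends only on the difference of its sides, so rearranging one reduces to a ring
-- identity.
≤-shift : ∀ {p q p′ q′} → p ≤ℚ q → q -ℚ p ≡ q′ -ℚ p′ → p′ ≤ℚ q′
≤-shift {p} {q} {p′} {q′} p≤q e = begin
  p′                   ≡⟨ sym (ℚ.+-identityʳ p′) ⟩
  p′ +ℚ 0ℚ             ≡⟨ cong (p′ +ℚ_) (sym (ℚ.+-inverseʳ p)) ⟩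
  p′ +ℚ (p -ℚ p)       ≤⟨ ℚ.+-monoʳ-≤ p′ (ℚ.+-monoˡ-≤ (-ℚ p) p≤q) ⟩
  p′ +ℚ (q -ℚ p)       ≡⟨ cong (p′ +ℚ_) e ⟩
  p′ +ℚ (q′ -ℚ p′)     ≡⟨ ℚS.solve 2 (λ p q → p ℚS.:+ (q ℚS.:- p) ℚS.:= q) refl p′ q′ ⟩
  q′                   ∎
  where open ℚ.≤-Reasoning

0≤* : ∀ {p q} → 0ℚ ≤ℚ p → 0ℚ ≤ℚ q → 0ℚ ≤ℚ p *ℚ q
0≤* {p} {q} 0≤p 0≤q = ℚ.≤-trans (ℚ.≤-reflexive (sym (ℚ.*-zeroʳ p))) (ℚ.*-monoˡ-≤-nonNeg p {{ℚ.nonNegative 0≤p}} 0≤q)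

0≤+ : ∀ {p q} → 0ℚ ≤ℚ p → 0ℚ ≤ℚ q → 0ℚ ≤ℚ p +ℚ q
0≤+ 0≤p 0≤q = ℚ.+-mono-≤ 0≤p 0≤q

0≤- : ∀ {p q} → p ≤ℚ q → 0ℚ ≤ℚ q -ℚ p
0≤- {p} {q} p≤q = ≤-shift p≤q (ℚS.solve 2 (λ p q → q ℚS.:- p ℚS.:= (q ℚS.:- p) ℚS.:- ℚS.con 0ℚ) refl p q)

-- Convex combinations

mix : ℚ → ℚ → ℚ → ℚ
mix t a b = t *ℚ a +ℚ (1ℚ -ℚ t) *ℚ b

between : ∀ {a y b} → a ≤ℚ y → y ≤ℚ b → ∃ λ t → 0ℚ ≤ℚ t × t ≤ℚ 1ℚ × y ≡ mix t a b
between {a} {y} {b} a≤y y≤b with a ℚ.≟ b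
... | yes refl = 1ℚ , ℚ.nonNegative⁻¹ 1ℚ , ℚ.≤-refl , trans (ℚ.≤-antisym y≤b a≤y)
  (ℚS.solve 1 (λ a → a ℚS.:= ℚS.con 1ℚ ℚS.:* a ℚS.:+ (ℚS.con 1ℚ ℚS.:- ℚS.con 1ℚ) ℚS.:* a) refl a)
-- The weight is `(b - y) / (b - a)`; the case `a ≡ b` is separate because of the division.
... | no a≢b = t , 0≤* (0≤- y≤b) 0≤i , t≤1 , y≡
  where
  d = b -ℚ a
  d-pos : Positive d
  d-pos = ℚ.positive (ℚ.≰⇒> λ d≤0 → a≢b (trans (sym (ℚ.+-identityʳ a))
    (trans (cong (a +ℚ_) (ℚ.≤-antisym (0≤- (ℚ.≤-trans a≤y y≤b)) d≤0)) (ℚS.solve 2 (λ a b → a ℚS.:+ (b ℚS.:- a) ℚS.:= b) refl a b))))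
  instance
    d≢0 : NonZero d
    d≢0 = ℚ.pos⇒nonZero d {{d-pos}}
  i = 1/ d
  0≤i : 0ℚ ≤ℚ i
  0≤i = ℚ.<⇒≤ (ℚ.positive⁻¹ i {{ℚ.1/pos⇒pos d {{d-pos}}}})
  t = (b -ℚ y) *ℚ i
  t≤1 : t ≤ℚ 1ℚ
  t≤1 = ℚ.≤-trans (ℚ.*-monoʳ-≤-nonNeg i {{ℚ.nonNegative 0≤i}} (≤-shift {a} {y} {b -ℚ y} {b -ℚ a} a≤y (ℚS.solve 3 (λ a y b → y ℚS.:- a ℚS.:= (b ℚS.:- a) ℚS.:- (b ℚS.:- y)) refl a y b)))
    (ℚ.≤-reflexive (ℚ.*-inverseʳ d))
  y≡ : y ≡ mix t a b
  y≡ = trans (ℚS.solve 2 (λ b y → y ℚS.:= b ℚS.:- (b ℚS.:- y) ℚS.:* ℚS.con 1ℚ) refl b y)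
    (trans (cong (λ z → b -ℚ (b -ℚ y) *ℚ z) (sym (ℚ.*-inverseˡ d)))
    (ℚS.solve 4 (λ a b y i → b ℚS.:- (b ℚS.:- y) ℚS.:* (i ℚS.:* (b ℚS.:- a))
      ℚS.:= ((b ℚS.:- y) ℚS.:* i) ℚS.:* a ℚS.:+ (ℚS.con 1ℚ ℚS.:- (b ℚS.:- y) ℚS.:* i) ℚS.:* b) refl a b y i))

module _ {S : Point → Set} where

  conv-≤ : ∀ A B C → (∀ x y → S (x , y) → A *ℚ x +ℚ B *ℚ y ≤ℚ C) → ∀ {x y} → InConv S (x , y) → A *ℚ x +ℚ B *ℚ y ≤ℚ C
  conv-≤ A B C h (ws , ok , sum≡1 , refl , refl) =
    ℚ.≤-trans (go ws ok) (ℚ.≤-reflexive (trans (cong (C *ℚ_) sum≡1) (ℚ.*-identityʳ C)))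
    where
    go : ∀ ws → AllOK S ws → A *ℚ combX ws +ℚ B *ℚ combY ws ≤ℚ C *ℚ sumW ws
    go [] [] = ℚ.≤-reflexive (ℚS.solve 3 (λ A B C → A ℚS.:* ℚS.con 0ℚ ℚS.:+ B ℚS.:* ℚS.con 0ℚ ℚS.:= C ℚS.:* ℚS.con 0ℚ) refl A B C)
    go ((l , (x , y)) ∷ ws) ((0≤l , xy∈S) ∷ ok) = begin
      A *ℚ (l *ℚ x +ℚ combX ws) +ℚ B *ℚ (l *ℚ y +ℚ combY ws)
        ≡⟨ ℚS.solve 7 (λ A B l x y X Y → A ℚS.:* (l ℚS.:* x ℚS.:+ X) ℚS.:+ B ℚS.:* (l ℚS.:* y ℚS.:+ Y)
             ℚS.:= l ℚS.:* (A ℚS.:* x ℚS.:+ B ℚS.:* y) ℚS.:+ (A ℚS.:* X ℚS.:+ B ℚS.:* Y)) refl A B l x y (combX ws) (combY ws) ⟩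
      l *ℚ (A *ℚ x +ℚ B *ℚ y) +ℚ (A *ℚ combX ws +ℚ B *ℚ combY ws)
        ≤⟨ ℚ.+-mono-≤ (ℚ.*-monoˡ-≤-nonNeg l {{ℚ.nonNegative 0≤l}} (h x y xy∈S)) (go ws ok) ⟩
      l *ℚ C +ℚ C *ℚ sumW ws
        ≡⟨ ℚS.solve 3 (λ l C s → l ℚS.:* C ℚS.:+ C ℚS.:* s ℚS.:= C ℚS.:* (l ℚS.:+ s)) refl l C (sumW ws) ⟩
      C *ℚ (l +ℚ sumW ws) ∎
      where open ℚ.≤-Reasoning

  conv-point : ∀ {p} → S p → InConv S p
  conv-point {x , y} xy∈S = (1ℚ , (x , y)) ∷ [] , (ℚ.nonNegative⁻¹ 1ℚ , xy∈S) ∷ [] , refl , 1*x+0 x , 1*x+0 y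
    where
    1*x+0 : ∀ x → 1ℚ *ℚ x +ℚ 0ℚ ≡ x
    1*x+0 = ℚS.solve 1 (λ x → ℚS.con 1ℚ ℚS.:* x ℚS.:+ ℚS.con 0ℚ ℚS.:= x) refl

  -- The accumulator `vs` makes a mixture of two combinations a nested `scale`, so concatenation
  -- needs no separate lemmas.
  scale : ℚ → List (ℚ × Point) → List (ℚ × Point) → List (ℚ × Point)
  scale t [] vs = vs
  scale t ((l , p) ∷ ws) vs = (t *ℚ l , p) ∷ scale t ws vs

  scale-OK : ∀ {t} → 0ℚ ≤ℚ t → ∀ {ws vs} → AllOK S ws → AllOK S vs → AllOK S (scale t ws vs)
  scale-OK 0≤t [] oks = oks
  scale-OK 0≤t ((0≤l , p∈S) ∷ ok) oks = (0≤* 0≤t 0≤l , p∈S) ∷ scale-OK 0≤t ok oks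

  scale-sumW : ∀ t ws vs → sumW (scale t ws vs) ≡ t *ℚ sumW ws +ℚ sumW vs
  scale-sumW t [] vs = ℚS.solve 2 (λ t v → v ℚS.:= t ℚS.:* ℚS.con 0ℚ ℚS.:+ v) refl t (sumW vs)
  scale-sumW t ((l , _) ∷ ws) vs = trans (cong (t *ℚ l +ℚ_) (scale-sumW t ws vs))
    (ℚS.solve 4 (λ t l w v → t ℚS.:* l ℚS.:+ (t ℚS.:* w ℚS.:+ v) ℚS.:= t ℚS.:* (l ℚS.:+ w) ℚS.:+ v) refl t l (sumW ws) (sumW vs))

  scale-combX : ∀ t ws vs → combX (scale t ws vs) ≡ t *ℚ combX ws +ℚ combX vs
  scale-combX t [] vs = ℚS.solve 2 (λ t v → v ℚS.:= t ℚS.:* ℚS.con 0ℚ ℚS.:+ v) refl t (combX vs)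
  scale-combX t ((l , (x , _)) ∷ ws) vs = trans (cong (t *ℚ l *ℚ x +ℚ_) (scale-combX t ws vs))
    (ℚS.solve 5 (λ t l x w v → t ℚS.:* l ℚS.:* x ℚS.:+ (t ℚS.:* w ℚS.:+ v) ℚS.:= t ℚS.:* (l ℚS.:* x ℚS.:+ w) ℚS.:+ v) refl t l x (combX ws) (combX vs))

  scale-combY : ∀ t ws vs → combY (scale t ws vs) ≡ t *ℚ combY ws +ℚ combY vs
  scale-combY t [] vs = ℚS.solve 2 (λ t v → v ℚS.:= t ℚS.:* ℚS.con 0ℚ ℚS.:+ v) refl t (combY vs)
  scale-combY t ((l , (_ , y)) ∷ ws) vs = trans (cong (t *ℚ l *ℚ y +ℚ_) (scale-combY t ws vs))
    (ℚS.solve 5 (λ t l x w v → t ℚS.:* l ℚS.:* x ℚS.:+ (t ℚS.:* w ℚS.:+ v) ℚS.:= t ℚS.:* (l ℚS.:* x ℚS.:+ w) ℚS.:+ v) refl t l y (combY ws) (combY vs))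

  conv-mix : ∀ {x₁ y₁ x₂ y₂ t} → 0ℚ ≤ℚ t → t ≤ℚ 1ℚ → InConv S (x₁ , y₁) → InConv S (x₂ , y₂) →
    InConv S (mix t x₁ x₂ , mix t y₁ y₂)
  conv-mix {t = t} 0≤t t≤1 (ws , ok , s , refl , refl) (vs , ok′ , s′ , refl , refl) =
    scale t ws (scale u vs []) , scale-OK 0≤t ok (scale-OK (0≤- t≤1) ok′ []) ,
    trans (scale-sumW t ws (scale u vs [])) (trans (cong₂ (λ a b → t *ℚ a +ℚ b) s (trans (scale-sumW u vs []) (cong (λ a → u *ℚ a +ℚ 0ℚ) s′)))
      (ℚS.solve 1 (λ t → t ℚS.:* ℚS.con 1ℚ ℚS.:+ ((ℚS.con 1ℚ ℚS.:- t) ℚS.:* ℚS.con 1ℚ ℚS.:+ ℚS.con 0ℚ) ℚS.:= ℚS.con 1ℚ) refl t)) ,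
    trans (scale-combX t ws (scale u vs [])) (cong (t *ℚ combX ws +ℚ_) (trans (scale-combX u vs []) (ℚ.+-identityʳ _))) ,
    trans (scale-combY t ws (scale u vs [])) (cong (t *ℚ combY ws +ℚ_) (trans (scale-combY u vs []) (ℚ.+-identityʳ _)))
    where
    u = 1ℚ -ℚ t

-- The inequalities at points with natural coordinates

ℤ-+-cancelʳ-≤ : ∀ c a b → a ℤ.+ c ℤ.≤ b ℤ.+ c → a ℤ.≤ b
ℤ-+-cancelʳ-≤ c a b h = subst₂ ℤ._≤_ (cancel a) (cancel b) (ℤ.+-monoˡ-≤ (ℤ.- c) h)
  where
  cancel : ∀ a → a ℤ.+ c ℤ.+ ℤ.- c ≡ a
  cancel a = ℤS.solve 2 (λ a c → a ℤS.:+ c ℤS.:+ ℤS.:- c ℤS.:= a) refl a c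

ℤ-+-cancelʳ-≡ : ∀ c a b → a ℤ.+ c ≡ b ℤ.+ c → a ≡ b
ℤ-+-cancelʳ-≡ c a b h = ℤ.≤-antisym (ℤ-+-cancelʳ-≤ c a b (ℤ.≤-reflexive h)) (ℤ-+-cancelʳ-≤ c b a (ℤ.≤-reflexive (sym h)))

lowerℤ : ℕ → ℕ → ℕ → ℤ
lowerℤ n k a = (+ (2 ^ k) ℤ.- + 1) ℤ.* + a ℤ.+ + (2 ^ k) ℤ.* (+ 1 ℤ.- + k) ℤ.+ + n

lowerRHS-ℕ→ℚ : ∀ n k a → lowerRHS n k (ℕ→ℚ a) ≡ ℤ→ℚ (lowerℤ n k a)
lowerRHS-ℕ→ℚ n k a = sym (trans (ℤ→ℚ-+ (u ℤ.* + a ℤ.+ w) (+ n)) (cong (_+ℚ ℕ→ℚ n)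
  (trans (ℤ→ℚ-+ (u ℤ.* + a) w) (cong (_+ℚ ℤ→ℚ w) (ℤ→ℚ-* u (+ a))))))
  where
  u = + (2 ^ k) ℤ.- + 1
  w = + (2 ^ k) ℤ.* (+ 1 ℤ.- + k)

-- Subtractions are avoided by moving 2 ^ k * k to the left.
lowerℤ-value : ∀ {n} k a c → a + c ≡ n → lowerℤ n k a ℤ.+ + (2 ^ k * k) ≡ + (2 ^ k * suc a + c)
lowerℤ-value k a c refl = begin
  lowerℤ (a + c) k a ℤ.+ + (2 ^ k * k)
    ≡⟨ cong (λ z → lowerℤ (a + c) k a ℤ.+ z) (ℤ.pos-* (2 ^ k) k) ⟩
  (+ (2 ^ k) ℤ.- + 1) ℤ.* + a ℤ.+ + (2 ^ k) ℤ.* (+ 1 ℤ.- + k) ℤ.+ (+ a ℤ.+ + c) ℤ.+ + (2 ^ k) ℤ.* + k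
    ≡⟨ ℤS.solve 4 (λ P a c k → (P ℤS.:- ℤS.con 1ℤ) ℤS.:* a ℤS.:+ P ℤS.:* (ℤS.con 1ℤ ℤS.:- k) ℤS.:+ (a ℤS.:+ c) ℤS.:+ P ℤS.:* k
         ℤS.:= P ℤS.:* (ℤS.con 1ℤ ℤS.:+ a) ℤS.:+ c) refl (+ (2 ^ k)) (+ a) (+ c) (+ k) ⟩
  + (2 ^ k) ℤ.* + suc a ℤ.+ + c
    ≡⟨ cong (λ z → z ℤ.+ + c) (sym (ℤ.pos-* (2 ^ k) (suc a))) ⟩
  + (2 ^ k * suc a + c) ∎
  where open ≡-Reasoning

module _ {n : ℕ} (k a c : ℕ) (a+c : a + c ≡ n) where

  lower-≤ : ∀ f → 2 ^ k * suc a + c ≤ f + 2 ^ k * k → lowerRHS n k (ℕ→ℚ a) ≤ℚ ℕ→ℚ f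
  lower-≤ f h = ℚ.≤-trans (ℚ.≤-reflexive (lowerRHS-ℕ→ℚ n k a)) (ℤ→ℚ-mono-≤
    (ℤ-+-cancelʳ-≤ (+ (2 ^ k * k)) (lowerℤ n k a) (+ f) (ℤ.≤-trans (ℤ.≤-reflexive (lowerℤ-value k a c a+c)) (ℤ.+≤+ h))))

  lower-tight : ∀ f → f + 2 ^ k * k ≡ 2 ^ k * suc a + c → ℕ→ℚ f ≡ lowerRHS n k (ℕ→ℚ a)
  lower-tight f h = trans (cong ℤ→ℚ (ℤ-+-cancelʳ-≡ (+ (2 ^ k * k)) (+ f) (lowerℤ n k a)
    (trans (cong +_ h) (sym (lowerℤ-value k a c a+c))))) (sym (lowerRHS-ℕ→ℚ n k a))

  lower-tight⁻ : ∀ f → ℕ→ℚ f ≡ lowerRHS n k (ℕ→ℚ a) → f + 2 ^ k * k ≡ 2 ^ k * suc a + c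
  lower-tight⁻ f h = ℤ.+-injective (trans (cong (λ z → z ℤ.+ + (2 ^ k * k)) (ℤ→ℚ-injective {+ f} {lowerℤ n k a} (trans h (lowerRHS-ℕ→ℚ n k a))))
    (lowerℤ-value k a c a+c))

module _ (N x : ℕ) where

  upperℤ : ℤ
  upperℤ = (+ (2 ^ suc N) ℤ.- + (2 + N)) ℤ.* (+ suc x ℤ.- 1ℤ) ℤ.+ + N ℤ.* + (2 + N + 1)

  upperRHS-ℕ→ℚ : upperRHS (2 + N) (ℕ→ℚ (suc x)) ≡ ℤ→ℚ upperℤ
  upperRHS-ℕ→ℚ = sym (trans (ℤ→ℚ-+ (u ℤ.* z) (+ N ℤ.* w)) (cong₂ _+ℚ_
    (trans (ℤ→ℚ-* u z) (cong (ℤ→ℚ u *ℚ_) (ℤ→ℚ-1 (+ suc x))))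
    (ℤ→ℚ-* (+ N) w)))
    where
    u = + (2 ^ suc N) ℤ.- + (2 + N)
    z = + suc x ℤ.- 1ℤ
    w = + (2 + N + 1)

  upperℤ-value : upperℤ ℤ.+ + ((N + 2) * x) ≡ + (N * (N + 3) + 2 ^ (N + 1) * x)
  upperℤ-value = begin
    upperℤ ℤ.+ + ((N + 2) * x)
      ≡⟨ cong (λ z → upperℤ ℤ.+ z) (ℤ.pos-* (N + 2) x) ⟩
    (P ℤ.- (+ 2 ℤ.+ + N)) ℤ.* (1ℤ ℤ.+ + x ℤ.- 1ℤ) ℤ.+ + N ℤ.* (+ 2 ℤ.+ + N ℤ.+ + 1) ℤ.+ (+ N ℤ.+ + 2) ℤ.* + x
      ≡⟨ ℤS.solve 3 (λ P N x → (P ℤS.:- (ℤS.con (+ 2) ℤS.:+ N)) ℤS.:* (ℤS.con 1ℤ ℤS.:+ x ℤS.:- ℤS.con 1ℤ) ℤS.:+ N ℤS.:* (ℤS.con (+ 2) ℤS.:+ N ℤS.:+ ℤS.con 1ℤ) ℤS.:+ (N ℤS.:+ ℤS.con (+ 2)) ℤS.:* x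
           ℤS.:= N ℤS.:* (N ℤS.:+ ℤS.con (+ 3)) ℤS.:+ P ℤS.:* x) refl P (+ N) (+ x) ⟩
    + N ℤ.* + (N + 3) ℤ.+ P ℤ.* + x
      ≡⟨ cong₂ ℤ._+_ (sym (ℤ.pos-* N (N + 3))) (trans (sym (ℤ.pos-* (2 ^ suc N) x)) (cong (λ z → + (2 ^ z * x)) (+-comm 1 N))) ⟩
    + (N * (N + 3) + 2 ^ (N + 1) * x) ∎
    where
    open ≡-Reasoning
    P = + (2 ^ suc N)

  upperLHS-ℕ→ℚ : ∀ f → upperLHS (2 + N) (ℕ→ℚ f) ≡ ℕ→ℚ (N * f)
  upperLHS-ℕ→ℚ f = trans (sym (ℤ→ℚ-* (+ N) (+ f))) (cong ℤ→ℚ (sym (ℤ.pos-* N f)))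

  upper-≤ : ∀ f → Upper N x f → upperLHS (2 + N) (ℕ→ℚ f) ≤ℚ upperRHS (2 + N) (ℕ→ℚ (suc x))
  upper-≤ f (mkUpper h) = ℚ.≤-trans (ℚ.≤-reflexive (upperLHS-ℕ→ℚ f)) (ℚ.≤-trans (ℤ→ℚ-mono-≤
    (ℤ-+-cancelʳ-≤ (+ ((N + 2) * x)) (+ (N * f)) upperℤ (ℤ.≤-trans (ℤ.+≤+ h) (ℤ.≤-reflexive (sym upperℤ-value)))))
    (ℚ.≤-reflexive (sym upperRHS-ℕ→ℚ)))

  upper-tight : ∀ f → N * f + (N + 2) * x ≡ N * (N + 3) + 2 ^ (N + 1) * x →
    upperLHS (2 + N) (ℕ→ℚ f) ≡ upperRHS (2 + N) (ℕ→ℚ (suc x))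
  upper-tight f h = trans (upperLHS-ℕ→ℚ f) (trans (cong ℤ→ℚ
    (ℤ-+-cancelʳ-≡ (+ ((N + 2) * x)) (+ (N * f)) upperℤ (trans (cong +_ h) (sym upperℤ-value)))) (sym upperRHS-ℕ→ℚ))

  upper-tight⁻ : ∀ f → upperLHS (2 + N) (ℕ→ℚ f) ≡ upperRHS (2 + N) (ℕ→ℚ (suc x)) →
    N * f + (N + 2) * x ≡ N * (N + 3) + 2 ^ (N + 1) * x
  upper-tight⁻ f h = ℤ.+-injective (trans (cong (λ z → z ℤ.+ + ((N + 2) * x))
    (ℤ→ℚ-injective {+ (N * f)} {upperℤ} (trans (sym (upperLHS-ℕ→ℚ f)) (trans h upperRHS-ℕ→ℚ)))) upperℤ-value)

-- Convexity of the powers of two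

suc≤2^ : ∀ d → suc d ≤ 2 ^ d
suc≤2^ zero = ≤-refl
suc≤2^ (suc d) = ≤-trans (+-mono-≤ (m^n>0 2 d) (suc≤2^ d)) (≤-reflexive (2^-double d))

-- Divided by `2 ^ k`, this is `1 + (a - k) ≤ 2 ^ (a - k)`: Bernoulli's inequality for `a ≥ k`, and
-- trivial for `a < k`, where the left side is not positive.
tangent : ∀ k a → 2 ^ k * suc a ≤ 2 ^ a + 2 ^ k * k
tangent k a with ≤-total k a
... | inj₁ k≤a with m≤n⇒∃[o]m+o≡n k≤a
...   | d , refl = begin
  2 ^ k * suc (k + d)          ≡⟨ cong (2 ^ k *_) (sym (+-suc k d)) ⟩
  2 ^ k * (k + suc d)          ≡⟨ *-distribˡ-+ (2 ^ k) k (suc d) ⟩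
  2 ^ k * k + 2 ^ k * suc d    ≤⟨ +-monoʳ-≤ (2 ^ k * k) (*-monoʳ-≤ (2 ^ k) (suc≤2^ d)) ⟩
  2 ^ k * k + 2 ^ k * 2 ^ d    ≡⟨ cong (λ z → 2 ^ k * k + z) (sym (^-distribˡ-+-* 2 k d)) ⟩
  2 ^ k * k + 2 ^ (k + d)      ≡⟨ +-comm (2 ^ k * k) _ ⟩
  2 ^ (k + d) + 2 ^ k * k      ∎
  where open ≤-Reasoning
tangent k a | inj₂ a≤k with m≤n⇒m<n∨m≡n a≤k
... | inj₁ a<k = ≤-trans (*-monoʳ-≤ (2 ^ k) a<k) (m≤n+m _ (2 ^ a))
... | inj₂ refl = ≤-reflexive (*-suc (2 ^ k) k)

-- (2 ^ x - 1) / x is strictly increasing.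
chord-strict : ∀ x d → 1 ≤ x → (x + suc d) * 2 ^ x + x < x * 2 ^ (x + suc d) + (x + suc d)
chord-strict x zero 1≤x = begin-strict
  (x + 1) * P + x              ≡⟨ solve 2 (λ x P → (x :+ con 1) :* P :+ x := x :* P :+ (P :+ x)) refl x P ⟩
  x * P + (P + x)              <⟨ +-monoʳ-< (x * P) (+-monoˡ-< x (≤-<-trans P≤xP (n<1+n (x * P)))) ⟩
  x * P + (suc (x * P) + x)    ≡⟨ solve 2 (λ x P → x :* P :+ (con 1 :+ x :* P :+ x) := x :* (con 2 :* P) :+ (x :+ con 1)) refl x P ⟩
  x * 2 ^ suc x + (x + 1)      ≡⟨ cong (λ z → x * 2 ^ z + (x + 1)) (+-comm 1 x) ⟩
  x * 2 ^ (x + 1) + (x + 1)    ∎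
  where
  open ≤-Reasoning
  P = 2 ^ x
  P≤xP : P ≤ x * P
  P≤xP = ≤-trans (≤-reflexive (sym (*-identityˡ P))) (*-monoˡ-≤ P 1≤x)
chord-strict x (suc d) 1≤x = begin-strict
  (x + suc (suc d)) * P + x           ≡⟨ solve 3 (λ x d P → (x :+ (con 2 :+ d)) :* P :+ x := (x :+ (con 1 :+ d)) :* P :+ x :+ P) refl x d P ⟩
  (x + suc d) * P + x + P             <⟨ +-mono-<-≤ (chord-strict x d 1≤x) P≤ ⟩
  x * Q + (x + suc d) + (x * Q + 1)   ≡⟨ solve 3 (λ x d Q → x :* Q :+ (x :+ (con 1 :+ d)) :+ (x :* Q :+ con 1) := x :* (con 2 :* Q) :+ (x :+ (con 2 :+ d))) refl x d Q ⟩
  x * 2 ^ suc (x + suc d) + (x + suc (suc d))   ≡⟨ cong (λ z → x * 2 ^ z + (x + suc (suc d))) (sym (+-suc x (suc d))) ⟩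
  x * 2 ^ (x + suc (suc d)) + (x + suc (suc d)) ∎
  where
  open ≤-Reasoning
  P = 2 ^ x
  Q = 2 ^ (x + suc d)
  P≤ : P ≤ x * Q + 1
  P≤ = ≤-trans (^-monoʳ-≤ 2 (m≤m+n x (suc d))) (≤-trans (≤-trans (≤-reflexive (sym (*-identityˡ Q))) (*-monoˡ-≤ Q 1≤x)) (m≤m+n _ 1))

-- The vertices strictly between the first and the last lie off the upper edge: after cancelling
-- `N * (N + 1)`, equality would be twice an equality of the chord slopes `(2 ^ x - 1) / x` and
-- `(2 ^ N - 1) / N`.
upper-strict : ∀ N x c → 1 ≤ x → x < N → suc x + c ≡ 2 + N → N * (2 ^ suc x + c) + (N + 2) * x ≢ N * (N + 3) + 2 ^ (N + 1) * x
upper-strict N x c 1≤x x<N x+c e with m≤n⇒∃[o]m+o≡n x<N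
... | d , refl = <⇒≢ (*-monoʳ-< 2 (chord-strict x d 1≤x)) (+-cancelˡ-≡ (N′ * (N′ + 1)) _ _ (begin
    N′ * (N′ + 1) + 2 * (N′ * P + x)          ≡⟨ cong (λ z → N′ * z + 2 * (N′ * P + x)) N′+1 ⟩
    N′ * (x + c) + 2 * (N′ * P + x)           ≡⟨ solve 4 (λ N x c P → N :* (x :+ c) :+ con 2 :* (N :* P :+ x) := N :* (con 2 :* P :+ c) :+ (N :+ con 2) :* x) refl N′ x c P ⟩
    N′ * (2 * P + c) + (N′ + 2) * x           ≡⟨ subst (λ M → M * (2 * P + c) + (M + 2) * x ≡ M * (M + 3) + 2 ^ (M + 1) * x) (sym (+-suc x d)) e ⟩
    N′ * (N′ + 3) + 2 ^ (N′ + 1) * x          ≡⟨ cong (λ z → N′ * (N′ + 3) + 2 ^ z * x) (+-comm N′ 1) ⟩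
    N′ * (N′ + 3) + 2 * Q * x                 ≡⟨ solve 3 (λ N x Q → N :* (N :+ con 3) :+ con 2 :* Q :* x := N :* (N :+ con 1) :+ con 2 :* (x :* Q :+ N)) refl N′ x Q ⟩
    N′ * (N′ + 1) + 2 * (x * Q + N′)          ∎))
  where
  open ≡-Reasoning
  N′ = x + suc d
  P = 2 ^ x
  Q = 2 ^ N′
  N′+1 : N′ + 1 ≡ x + c
  N′+1 = trans (+-comm N′ 1) (trans (cong suc (+-suc x d)) (sym (suc-injective x+c)))

2^-injective : ∀ {a b} → 2 ^ a ≡ 2 ^ b → a ≡ b
2^-injective {a} {b} e with <-cmp a b
... | tri< a<b _ _ = ⊥-elim (<⇒≢ (^-monoʳ-< 2 ≤-refl a<b) e)
... | tri≈ _ a≡b _ = a≡b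
... | tri> _ _ b<a = ⊥-elim (<⇒≢ (^-monoʳ-< 2 ≤-refl b<a) (sym e))

-- Lines in the plane and their intersections

mix-lowerRHS : ∀ n k t a b → mix t (lowerRHS n k a) (lowerRHS n k b) ≡ lowerRHS n k (mix t a b)
mix-lowerRHS n k t a b = ℚS.solve 6 (λ A B C t a b →
    t ℚS.:* (A ℚS.:* a ℚS.:+ B ℚS.:+ C) ℚS.:+ (ℚS.con 1ℚ ℚS.:- t) ℚS.:* (A ℚS.:* b ℚS.:+ B ℚS.:+ C)
    ℚS.:= A ℚS.:* (t ℚS.:* a ℚS.:+ (ℚS.con 1ℚ ℚS.:- t) ℚS.:* b) ℚS.:+ B ℚS.:+ C) refl
  (ℤ→ℚ (+ (2 ^ k) ℤ.- + 1)) (ℤ→ℚ (+ (2 ^ k) ℤ.* (+ 1 ℤ.- + k))) (ℕ→ℚ n) t a b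

mix-upperRHS : ∀ n t a b → mix t (upperRHS n a) (upperRHS n b) ≡ upperRHS n (mix t a b)
mix-upperRHS n t a b = ℚS.solve 5 (λ M E t a b →
    t ℚS.:* (M ℚS.:* (a ℚS.:- ℚS.con 1ℚ) ℚS.:+ E) ℚS.:+ (ℚS.con 1ℚ ℚS.:- t) ℚS.:* (M ℚS.:* (b ℚS.:- ℚS.con 1ℚ) ℚS.:+ E)
    ℚS.:= M ℚS.:* (t ℚS.:* a ℚS.:+ (ℚS.con 1ℚ ℚS.:- t) ℚS.:* b ℚS.:- ℚS.con 1ℚ) ℚS.:+ E) refl
  (ℤ→ℚ (+ (2 ^ (n ∸ 1)) ℤ.- + n)) (ℕ→ℚ (n ∸ 2) *ℚ ℕ→ℚ (n + 1)) t a b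

mix-*ˡ : ∀ m t a b → mix t (m *ℚ a) (m *ℚ b) ≡ m *ℚ mix t a b
mix-*ˡ = ℚS.solve 4 (λ m t a b → t ℚS.:* (m ℚS.:* a) ℚS.:+ (ℚS.con 1ℚ ℚS.:- t) ℚS.:* (m ℚS.:* b)
  ℚS.:= m ℚS.:* (t ℚS.:* a ℚS.:+ (ℚS.con 1ℚ ℚS.:- t) ℚS.:* b)) refl

0≤ℕ : ∀ m → 0ℚ ≤ℚ ℕ→ℚ m
0≤ℕ m = ℤ→ℚ-mono-≤ {+ 0} {+ m} (ℤ.+≤+ z≤n)

-- A point above one line and below a second line lies on a definite side of their intersection.
crossing : ∀ A B C m M E {x₀ x y} → 0ℚ ≤ℚ m → m *ℚ (A *ℚ x₀ +ℚ B +ℚ C) ≡ M *ℚ (x₀ -ℚ 1ℚ) +ℚ E →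
  A *ℚ x +ℚ B +ℚ C ≤ℚ y → m *ℚ y ≤ℚ M *ℚ (x -ℚ 1ℚ) +ℚ E → 0ℚ ≤ℚ (m *ℚ A -ℚ M) *ℚ (x₀ -ℚ x)
crossing A B C m M E {x₀} {x} {y} 0≤m e lo up = begin
  0ℚ
    ≤⟨ 0≤+ (0≤- up) (0≤* 0≤m (0≤- lo)) ⟩
  (M *ℚ (x -ℚ 1ℚ) +ℚ E -ℚ m *ℚ y) +ℚ m *ℚ (y -ℚ (A *ℚ x +ℚ B +ℚ C))
    ≡⟨ cong₂ (λ u l → (u -ℚ m *ℚ y) +ℚ m *ℚ (y -ℚ l)) upper-at-x lower-at-x ⟩
  (m *ℚ L -ℚ M *ℚ d -ℚ m *ℚ y) +ℚ m *ℚ (y -ℚ (L -ℚ A *ℚ d))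
    ≡⟨ ℚS.solve 6 (λ m L M d y A → (m ℚS.:* L ℚS.:- M ℚS.:* d ℚS.:- m ℚS.:* y) ℚS.:+ m ℚS.:* (y ℚS.:- (L ℚS.:- A ℚS.:* d))
         ℚS.:= (m ℚS.:* A ℚS.:- M) ℚS.:* d) refl m L M d y A ⟩
  (m *ℚ A -ℚ M) *ℚ d ∎
  where
  open ℚ.≤-Reasoning
  d L : ℚ
  d = x₀ -ℚ x
  L = A *ℚ x₀ +ℚ B +ℚ C
  lower-at-x : A *ℚ x +ℚ B +ℚ C ≡ L -ℚ A *ℚ d
  lower-at-x = ℚS.solve 5 (λ A B C x₀ x → A ℚS.:* x ℚS.:+ B ℚS.:+ C
    ℚS.:= (A ℚS.:* x₀ ℚS.:+ B ℚS.:+ C) ℚS.:- A ℚS.:* (x₀ ℚS.:- x)) refl A B C x₀ x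
  upper-at-x : M *ℚ (x -ℚ 1ℚ) +ℚ E ≡ m *ℚ L -ℚ M *ℚ d
  upper-at-x = trans (ℚS.solve 4 (λ M E x₀ x → M ℚS.:* (x ℚS.:- ℚS.con 1ℚ) ℚS.:+ E
    ℚS.:= (M ℚS.:* (x₀ ℚS.:- ℚS.con 1ℚ) ℚS.:+ E) ℚS.:- M ℚS.:* (x₀ ℚS.:- x)) refl M E x₀ x) (cong (_-ℚ M *ℚ d) (sym e))

positive-cancel : ∀ d {z} → 0ℚ ≤ℚ ℕ→ℚ (suc d) *ℚ z → 0ℚ ≤ℚ z
positive-cancel d {z} h = ℚ.*-cancelˡ-≤-pos (ℕ→ℚ (suc d)) {{ℤ→ℚ-positive d}} (ℚ.≤-trans (ℚ.≤-reflexive (ℚ.*-zeroʳ (ℕ→ℚ (suc d)))) h)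

0≤-⁻ : ∀ {p q} → 0ℚ ≤ℚ q -ℚ p → p ≤ℚ q
0≤-⁻ {p} {q} h = ≤-shift h (ℚS.solve 2 (λ p q → (q ℚS.:- p) ℚS.:- ℚS.con 0ℚ ℚS.:= q ℚS.:- p) refl p q)

locate : ∀ (f : ℕ → ℚ) m {x} → f 0 ≤ℚ x → x ≤ℚ f (suc m) → ∃ λ k → k ≤ m × f k ≤ℚ x × x ≤ℚ f (suc k)
locate f zero lo hi = 0 , z≤n , lo , hi
locate f (suc m) {x} lo hi with ℚ.≤-total x (f (suc m))
... | inj₂ ge = suc m , ≤-refl , ge , hi
... | inj₁ le with locate f m lo le
...   | k , k≤m , lo′ , hi′ = k , m≤n⇒m≤1+n k≤m , lo′ , hi′

-- Points of the hull satisfy the inequalities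

upper-bound′ : ∀ N {t} → N ≡ 6 + t → (G : Graph (2 + N)) → Connected G → ∀ x c → α G ≡ suc x → N ≡ x + c → Upper N x (F G)
upper-bound′ _ refl = upper-bound _

-- N is kept a variable, as 2 ^ N would unfold for N = 6 + t.
module _ (N t : ℕ) (N≡6+t : N ≡ 6 + t) where

  private
    n : ℕ
    n = 2 + N

  index : ∀ k → k < N → Fin N
  index k k<N = fromℕ< k<N

  kOf-index : ∀ k (k<N : k < N) → kOf n (index k k<N) ≡ suc k
  kOf-index k k<N = cong suc (toℕ-fromℕ< k<N)

  vertex∈PC : ∀ a c → a + c ≡ n → 1 ≤ a → 1 ≤ c → PC n (ℕ→ℚ a , ℕ→ℚ (2 ^ a + c))
  vertex∈PC a c a+c 1≤a 1≤c = realise (vertex n a c a+c 1≤a 1≤c)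
    where
    realise : (∃ λ (G : Graph n) → Connected G × α G ≡ a × F G ≡ 2 ^ a + c) → PC n (ℕ→ℚ a , ℕ→ℚ (2 ^ a + c))
    realise (G , conn , α≡ , F≡) = conv-point {Realised n} {ℕ→ℚ a , ℕ→ℚ (2 ^ a + c)}
      (G , conn , cong ℕ→ℚ {a} {α G} (sym α≡) , cong ℕ→ℚ {2 ^ a + c} {F G} (sym F≡))

  module _ (G : Graph n) where

    coα : ℕ
    coα = n ∸ α G

    α+coα : α G + coα ≡ n
    α+coα = m+[n∸m]≡n (α≤n G)

    F-lower′ : ∀ k → 2 ^ k * suc (α G) + coα ≤ F G + 2 ^ k * k
    F-lower′ k = begin
      2 ^ k * suc (α G) + coα            ≤⟨ +-monoˡ-≤ coα (tangent k (α G)) ⟩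
      2 ^ α G + 2 ^ k * k + coα          ≡⟨ solve 3 (λ x y c → x :+ y :+ c := x :+ c :+ y) refl (2 ^ α G) (2 ^ k * k) coα ⟩
      2 ^ α G + coα + 2 ^ k * k          ≤⟨ +-monoˡ-≤ (2 ^ k * k) (F-lower G coα α+coα) ⟩
      F G + 2 ^ k * k                    ∎
      where open ≤-Reasoning

    F-upper : Connected G → ∃ λ x → α G ≡ suc x × Upper N x (F G)
    F-upper conn = go (α G) coα refl α+coα (1≤α G zero) (1≤n-α G conn zero (s≤s (s≤s z≤n)) coα α+coα)
      where
      go : ∀ a c → α G ≡ a → a + c ≡ n → 1 ≤ a → 1 ≤ c → ∃ λ x → α G ≡ suc x × Upper N x (F G)
      go (suc x) (suc c) α≡ a+c _ _ = x , α≡ , upper-bound′ N N≡6+t G conn x c α≡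
        (suc-injective (trans (sym (suc-injective a+c)) (+-suc x c)))

  realised-lower : ∀ k {x y} → Realised n (x , y) → lowerRHS n k x ≤ℚ y
  realised-lower k (G , conn , refl , refl) = lower-≤ {n} k (α G) (coα G) (α+coα G) (F G) (F-lower′ G k)

  realised-upper : ∀ {x y} → Realised n (x , y) → upperLHS n y ≤ℚ upperRHS n x
  realised-upper (G , conn , refl , refl) = go (α G) refl (F-upper G conn)
    where
    go : ∀ a → α G ≡ a → (∃ λ x → α G ≡ suc x × Upper N x (F G)) → upperLHS n (ℕ→ℚ (F G)) ≤ℚ upperRHS n (ℕ→ℚ a)
    go a α≡a (x , α≡ , h) = subst (λ a → upperLHS n (ℕ→ℚ (F G)) ≤ℚ upperRHS n (ℕ→ℚ a)) {suc x} {a} (trans (sym α≡) α≡a) (upper-≤ N x (F G) h)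

  -- Each inequality is brought into the form `A x + B y ≤ C`, which passes from realised points to
  -- their convex combinations, and is then brought back.
  PC⇒Holds : ∀ p → PC n p → ∀ ι → Holds n ι p
  PC⇒Holds (x , y) xy∈PC (lower i) = ≤-shift (conv-≤ A (-ℚ 1ℚ) (-ℚ (B +ℚ C)) onRealised xy∈PC) (sym (shift x y))
    where
    k = kOf n i
    A = ℤ→ℚ (+ (2 ^ k) ℤ.- + 1)
    B = ℤ→ℚ (+ (2 ^ k) ℤ.* (+ 1 ℤ.- + k))
    C = ℕ→ℚ n
    shift : ∀ x y → y -ℚ lowerRHS n k x ≡ -ℚ (B +ℚ C) -ℚ (A *ℚ x +ℚ -ℚ 1ℚ *ℚ y)
    shift x y = ℚS.solve 5 (λ A B C x y → y ℚS.:- (A ℚS.:* x ℚS.:+ B ℚS.:+ C)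
      ℚS.:= (ℚS.:- (B ℚS.:+ C)) ℚS.:- (A ℚS.:* x ℚS.:+ ℚS.con (-ℚ 1ℚ) ℚS.:* y)) refl A B C x y
    onRealised : ∀ x y → Realised n (x , y) → A *ℚ x +ℚ -ℚ 1ℚ *ℚ y ≤ℚ -ℚ (B +ℚ C)
    onRealised x y xy∈S = ≤-shift (realised-lower k xy∈S) (shift x y)
  PC⇒Holds (x , y) xy∈PC upper = ≤-shift (conv-≤ (-ℚ M) m (E -ℚ M) onRealised xy∈PC) (sym (shift x y))
    where
    M = ℤ→ℚ (+ (2 ^ (n ∸ 1)) ℤ.- + n)
    m = ℕ→ℚ N
    E = m *ℚ ℕ→ℚ (n + 1)
    shift : ∀ x y → upperRHS n x -ℚ upperLHS n y ≡ (E -ℚ M) -ℚ (-ℚ M *ℚ x +ℚ m *ℚ y)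
    shift x y = ℚS.solve 5 (λ M m E x y → (M ℚS.:* (x ℚS.:- ℚS.con 1ℚ) ℚS.:+ E) ℚS.:- m ℚS.:* y
      ℚS.:= (E ℚS.:- M) ℚS.:- ((ℚS.:- M) ℚS.:* x ℚS.:+ m ℚS.:* y)) refl M m E x y
    onRealised : ∀ x y → Realised n (x , y) → -ℚ M *ℚ x +ℚ m *ℚ y ≤ℚ E -ℚ M
    onRealised x y xy∈S = ≤-shift (realised-upper xy∈S) (shift x y)

-- Points satisfying the inequalities lie in the hull

ℤ→ℚ-− : ∀ a b → ℤ→ℚ (a ℤ.- b) ≡ ℤ→ℚ a -ℚ ℤ→ℚ b
ℤ→ℚ-− a b = begin
  ℤ→ℚ (a ℤ.- b)                          ≡⟨ ℚS.solve 2 (λ p q → p ℚS.:= p ℚS.:+ q ℚS.:- q) refl (ℤ→ℚ (a ℤ.- b)) (ℤ→ℚ b) ⟩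
  ℤ→ℚ (a ℤ.- b) +ℚ ℤ→ℚ b -ℚ ℤ→ℚ b        ≡⟨ cong (_-ℚ ℤ→ℚ b) (sym (ℤ→ℚ-+ (a ℤ.- b) b)) ⟩
  ℤ→ℚ (a ℤ.- b ℤ.+ b) -ℚ ℤ→ℚ b           ≡⟨ cong (λ z → ℤ→ℚ z -ℚ ℤ→ℚ b) (ℤS.solve 2 (λ a b → a ℤS.:- b ℤS.:+ b ℤS.:= a) refl a b) ⟩
  ℤ→ℚ a -ℚ ℤ→ℚ b                         ∎
  where open ≡-Reasoning

ℤ→ℚ-*− : ∀ N w u → ℤ→ℚ (+ N ℤ.* w ℤ.- u) ≡ ℕ→ℚ N *ℚ ℤ→ℚ w -ℚ ℤ→ℚ u
ℤ→ℚ-*− N w u = trans (ℤ→ℚ-− (+ N ℤ.* w) u) (cong (_-ℚ ℤ→ℚ u) (ℤ→ℚ-* (+ N) w))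

suc<2^ : ∀ N {t} → N ≡ 6 + t → suc N < 2 ^ N
suc<2^ _ {t} refl = <-≤-trans
  (≤-trans (m≤m+n (8 + t) (4 + t)) (≤-reflexive (solve 1 (λ t → con 8 :+ t :+ (con 4 :+ t) := con 6 :+ t :+ (con 6 :+ t :+ con 0)) refl t)))
  (*-monoʳ-≤ 2 (suc≤2^ (5 + t)))

-- Slopes are scaled by `N`. The lower line for `k = 1` rises less steeply than the upper edge, so
-- the region between them lies to the right of their common point `V_1`.
slope-first : ∀ N {t} → N ≡ 6 + t → ∃ λ d → + N ℤ.* (+ (2 ^ 1) ℤ.- + 1) ℤ.- (+ (2 ^ suc N) ℤ.- + (2 + N)) ≡ ℤ.- + suc d
slope-first N N≡ with m≤n⇒∃[o]m+o≡n (*-monoʳ-< 2 (suc<2^ N N≡))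
... | d , e = d , (begin
  + N ℤ.* 1ℤ ℤ.- (+ (2 ^ suc N) ℤ.- + (2 + N))
    ≡⟨ cong (λ z → + N ℤ.* 1ℤ ℤ.- (z ℤ.- + (2 + N))) (cong +_ (sym e)) ⟩
  + N ℤ.* 1ℤ ℤ.- (+ (suc (2 * suc N) + d) ℤ.- + (2 + N))
    ≡⟨ cong (λ z → + N ℤ.* 1ℤ ℤ.- (+ z ℤ.- + (2 + N))) (solve 2 (λ N d → con 1 :+ con 2 :* (con 1 :+ N) :+ d := (con 2 :+ N) :+ N :+ (con 1 :+ d)) refl N d) ⟩
  + N ℤ.* 1ℤ ℤ.- (+ (2 + N) ℤ.+ + N ℤ.+ + suc d ℤ.- + (2 + N))
    ≡⟨ ℤS.solve 3 (λ N M d → N ℤS.:* ℤS.con 1ℤ ℤS.:- (M ℤS.:+ N ℤS.:+ d ℤS.:- M) ℤS.:= ℤS.:- d) refl (+ N) (+ (2 + N)) (+ suc d) ⟩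
  ℤ.- + suc d ∎)
  where open ≡-Reasoning

-- The lower line for `k = N` is steeper than the upper edge, by `(N - 2) * 2 ^ N + 2` after
-- scaling, so the region lies to the left of their common point `V_{n-1}`.
slope-last : ∀ N {t} → N ≡ 6 + t → ∃ λ d → + N ℤ.* (+ (2 ^ N) ℤ.- + 1) ℤ.- (+ (2 ^ suc N) ℤ.- + (2 + N)) ≡ + suc d
slope-last N {t} N≡ = suc (s * P) , (begin
  + N ℤ.* (+ P ℤ.- + 1) ℤ.- (+ (2 * P) ℤ.- + (2 + N))
    ≡⟨ cong₂ (λ M z → M ℤ.* (+ P ℤ.- + 1) ℤ.- (z ℤ.- (+ 2 ℤ.+ M))) (cong +_ N≡) (ℤ.pos-* 2 P) ⟩
  (+ 2 ℤ.+ + s) ℤ.* (+ P ℤ.- + 1) ℤ.- (+ 2 ℤ.* + P ℤ.- (+ 2 ℤ.+ (+ 2 ℤ.+ + s)))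
    ≡⟨ ℤS.solve 2 (λ s P → (ℤS.con (+ 2) ℤS.:+ s) ℤS.:* (P ℤS.:- ℤS.con (+ 1)) ℤS.:- (ℤS.con (+ 2) ℤS.:* P ℤS.:- (ℤS.con (+ 2) ℤS.:+ (ℤS.con (+ 2) ℤS.:+ s)))
         ℤS.:= ℤS.con (+ 2) ℤS.:+ s ℤS.:* P) refl (+ s) (+ P) ⟩
  + 2 ℤ.+ + s ℤ.* + P
    ≡⟨ cong (λ z → + 2 ℤ.+ z) (sym (ℤ.pos-* s P)) ⟩
  + suc (suc (s * P)) ∎)
  where
  open ≡-Reasoning
  s = 4 + t
  P = 2 ^ N

module _ (N t : ℕ) (N≡6+t : N ≡ 6 + t) where

  private
    n : ℕ
    n = 2 + N

    1≤N : 1 ≤ N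
    1≤N = subst (1 ≤_) (sym N≡6+t) (s≤s z≤n)

  value : ℕ → ℕ
  value a = 2 ^ a + (n ∸ a)

  V∈PC : ∀ a → 1 ≤ a → a ≤ suc N → PC n (ℕ→ℚ a , ℕ→ℚ (value a))
  V∈PC a 1≤a a≤ = vertex∈PC N t N≡6+t a (n ∸ a) (m+[n∸m]≡n (m≤n⇒m≤1+n a≤)) 1≤a (m<n⇒0<n∸m (s≤s a≤))

  module _ (k : ℕ) (k≤N : k ≤ N) where

    left-tight : ℕ→ℚ (value k) ≡ lowerRHS n k (ℕ→ℚ k)
    left-tight = lower-tight {n} k k (n ∸ k) (m+[n∸m]≡n (≤-trans k≤N (m≤n+m N 2))) (value k)
      (solve 3 (λ P k c → P :+ c :+ P :* k := P :* (con 1 :+ k) :+ c) refl (2 ^ k) k (n ∸ k))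

    right-tight : ℕ→ℚ (value (suc k)) ≡ lowerRHS n k (ℕ→ℚ (suc k))
    right-tight = lower-tight {n} k (suc k) (n ∸ suc k) (m+[n∸m]≡n (s≤s (m≤n⇒m≤1+n k≤N))) (value (suc k))
      (solve 3 (λ P k c → con 2 :* P :+ c :+ P :* k := P :* (con 2 :+ k) :+ c) refl (2 ^ k) k (n ∸ suc k))

  first-tight : upperLHS n (ℕ→ℚ (value 1)) ≡ upperRHS n (ℕ→ℚ 1)
  first-tight = upper-tight N 0 (value 1)
    (solve 2 (λ N P → N :* (con 2 :+ (con 1 :+ N)) :+ (N :+ con 2) :* con 0 := N :* (N :+ con 3) :+ P :* con 0) refl N (2 ^ (N + 1)))

  last-tight : upperLHS n (ℕ→ℚ (value (suc N))) ≡ upperRHS n (ℕ→ℚ (suc N))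
  last-tight = upper-tight N N (value (suc N)) (trans
    (cong₂ (λ P c → N * (P + c) + (N + 2) * N) (cong (2 ^_) (+-comm 1 N)) (m+n∸n≡m 1 N))
    (solve 2 (λ N P → N :* (P :+ con 1) :+ (N :+ con 2) :* N := N :* (N :+ con 3) :+ P :* N) refl N (2 ^ (N + 1))))

  module _ {x y : ℚ} (holds : ∀ ι → Holds n ι (x , y)) where

    private
      m M E : ℚ
      m = ℕ→ℚ N
      M = ℤ→ℚ (+ (2 ^ suc N) ℤ.- + n)
      E = m *ℚ ℕ→ℚ (n + 1)

      A B : ℕ → ℚ
      A k = ℤ→ℚ (+ (2 ^ k) ℤ.- + 1)
      B k = ℤ→ℚ (+ (2 ^ k) ℤ.* (+ 1 ℤ.- + k))

    above : ∀ k → k < N → lowerRHS n (suc k) x ≤ℚ y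
    above k k<N = subst (λ l → lowerRHS n l x ≤ℚ y) (kOf-index N t N≡6+t k k<N) (holds (lower (index N t N≡6+t k k<N)))

    side : ∀ k x₀ y₀ → lowerRHS n (suc k) x ≤ℚ y → y₀ ≡ lowerRHS n (suc k) x₀ → upperLHS n y₀ ≡ upperRHS n x₀ →
      0ℚ ≤ℚ (m *ℚ A (suc k) -ℚ M) *ℚ (x₀ -ℚ x)
    side k x₀ y₀ lo lo₀ up₀ = crossing (A (suc k)) (B (suc k)) (ℕ→ℚ n) m M E {x₀} {x} {y} (0≤ℕ N)
      (trans (cong (m *ℚ_) (sym lo₀)) up₀) lo (holds upper)

    1≤x : ℕ→ℚ 1 ≤ℚ x
    1≤x = go (slope-first N N≡6+t) (side 0 (ℕ→ℚ 1) (ℕ→ℚ (value 1)) (above 0 1≤N) (left-tight 1 1≤N) first-tight)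
      where
      go : (∃ λ d → + N ℤ.* (+ (2 ^ 1) ℤ.- + 1) ℤ.- (+ (2 ^ suc N) ℤ.- + n) ≡ ℤ.- + suc d) →
        0ℚ ≤ℚ (m *ℚ A 1 -ℚ M) *ℚ (ℕ→ℚ 1 -ℚ x) → ℕ→ℚ 1 ≤ℚ x
      go (d , e) h = 0≤-⁻ {ℕ→ℚ 1} {x} (positive-cancel d (ℚ.≤-trans h (ℚ.≤-reflexive (begin
        (m *ℚ A 1 -ℚ M) *ℚ (ℕ→ℚ 1 -ℚ x)
          ≡⟨ cong (_*ℚ (ℕ→ℚ 1 -ℚ x)) (sym (ℤ→ℚ-*− N (+ (2 ^ 1) ℤ.- + 1) (+ (2 ^ suc N) ℤ.- + n))) ⟩
        ℤ→ℚ (+ N ℤ.* (+ (2 ^ 1) ℤ.- + 1) ℤ.- (+ (2 ^ suc N) ℤ.- + n)) *ℚ (ℕ→ℚ 1 -ℚ x)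
          ≡⟨ cong (λ z → ℤ→ℚ z *ℚ (ℕ→ℚ 1 -ℚ x)) (trans e (sym (ℤ.+-identityˡ (ℤ.- + suc d)))) ⟩
        ℤ→ℚ (+ 0 ℤ.- + suc d) *ℚ (ℕ→ℚ 1 -ℚ x)
          ≡⟨ cong (_*ℚ (ℕ→ℚ 1 -ℚ x)) (ℤ→ℚ-− (+ 0) (+ suc d)) ⟩
        (0ℚ -ℚ ℕ→ℚ (suc d)) *ℚ (ℕ→ℚ 1 -ℚ x)
          ≡⟨ ℚS.solve 3 (λ D u x → (ℚS.con 0ℚ ℚS.:- D) ℚS.:* (u ℚS.:- x) ℚS.:= D ℚS.:* (x ℚS.:- u)) refl (ℕ→ℚ (suc d)) (ℕ→ℚ 1) x ⟩
        ℕ→ℚ (suc d) *ℚ (x -ℚ ℕ→ℚ 1) ∎))))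
        where open ≡-Reasoning

    x≤1+N : x ≤ℚ ℕ→ℚ (suc N)
    x≤1+N = last N refl (slope-last N N≡6+t)
      where
      -- The lower lines are indexed by successors and `N` is a variable, so `k` is abstracted to be
      -- matched as a successor.
      last : ∀ k → k ≡ N → (∃ λ d → + N ℤ.* (+ (2 ^ k) ℤ.- + 1) ℤ.- (+ (2 ^ suc N) ℤ.- + n) ≡ + suc d) → x ≤ℚ ℕ→ℚ (suc N)
      last zero 0≡N _ = ⊥-elim (n≮0 (subst (1 ≤_) (sym 0≡N) 1≤N))
      last (suc k) k≡N (d , e) = 0≤-⁻ {x} {ℕ→ℚ (suc N)} (positive-cancel d (subst (λ z → 0ℚ ≤ℚ z *ℚ (ℕ→ℚ (suc N) -ℚ x))
          (trans (sym (ℤ→ℚ-*− N (+ (2 ^ suc k) ℤ.- + 1) (+ (2 ^ suc N) ℤ.- + n))) (cong ℤ→ℚ e))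
          (side k (ℕ→ℚ (suc N)) (ℕ→ℚ (value (suc N))) (above k (≤-reflexive k≡N))
            (subst (λ l → ℕ→ℚ (value (suc N)) ≡ lowerRHS n l (ℕ→ℚ (suc N))) (sym k≡N) (right-tight N ≤-refl)) last-tight)))

    lower-point : ∃ λ y₁ → PC n (x , y₁) × y₁ ≤ℚ y
    lower-point = go (locate (λ k → ℕ→ℚ (suc k)) (N ∸ 1) 1≤x (subst (λ l → x ≤ℚ ℕ→ℚ (suc l)) (sym 1+[N∸1]) x≤1+N))
      where
      1+[N∸1] : suc (N ∸ 1) ≡ N
      1+[N∸1] = m+[n∸m]≡n 1≤N
      go : (∃ λ k → k ≤ N ∸ 1 × ℕ→ℚ (suc k) ≤ℚ x × x ≤ℚ ℕ→ℚ (2 + k)) → ∃ λ y₁ → PC n (x , y₁) × y₁ ≤ℚ y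
      go (k , k≤ , k≤x , x≤k) = chord (between k≤x x≤k)
        where
        1+k≤N : suc k ≤ N
        1+k≤N = ≤-trans (s≤s k≤) (≤-reflexive 1+[N∸1])
        v₁ v₂ : ℚ
        v₁ = ℕ→ℚ (value (1 + k))
        v₂ = ℕ→ℚ (value (2 + k))
        chord : (∃ λ t → 0ℚ ≤ℚ t × t ≤ℚ 1ℚ × x ≡ mix t (ℕ→ℚ (1 + k)) (ℕ→ℚ (2 + k))) → ∃ λ y₁ → PC n (x , y₁) × y₁ ≤ℚ y
        chord (t , 0≤t , t≤1 , x≡) = mix t v₁ v₂ ,
          subst (λ z → PC n (z , mix t v₁ v₂)) (sym x≡)
            (conv-mix {Realised n} 0≤t t≤1 (V∈PC (1 + k) (s≤s z≤n) (m≤n⇒m≤1+n 1+k≤N)) (V∈PC (2 + k) (s≤s z≤n) (s≤s 1+k≤N))) ,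
          ℚ.≤-trans (ℚ.≤-reflexive (begin
            mix t v₁ v₂
              ≡⟨ cong₂ (mix t) (left-tight (suc k) 1+k≤N) (right-tight (suc k) 1+k≤N) ⟩
            mix t (lowerRHS n (suc k) (ℕ→ℚ (1 + k))) (lowerRHS n (suc k) (ℕ→ℚ (2 + k)))
              ≡⟨ mix-lowerRHS n (suc k) t (ℕ→ℚ (1 + k)) (ℕ→ℚ (2 + k)) ⟩
            lowerRHS n (suc k) (mix t (ℕ→ℚ (1 + k)) (ℕ→ℚ (2 + k)))
              ≡⟨ cong (lowerRHS n (suc k)) (sym x≡) ⟩
            lowerRHS n (suc k) x ∎)) (above k 1+k≤N)
          where open ≡-Reasoning

    upper-point : ∃ λ y₂ → PC n (x , y₂) × y ≤ℚ y₂
    upper-point = chord (between 1≤x x≤1+N)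
      where
      v₁ v₂ : ℚ
      v₁ = ℕ→ℚ (value 1)
      v₂ = ℕ→ℚ (value (suc N))
      m-positive : Positive m
      m-positive = subst (λ z → Positive (ℕ→ℚ z)) (m+[n∸m]≡n 1≤N) (ℤ→ℚ-positive (N ∸ 1))
      chord : (∃ λ t → 0ℚ ≤ℚ t × t ≤ℚ 1ℚ × x ≡ mix t (ℕ→ℚ 1) (ℕ→ℚ (suc N))) → ∃ λ y₂ → PC n (x , y₂) × y ≤ℚ y₂
      chord (t , 0≤t , t≤1 , x≡) = mix t v₁ v₂ ,
        subst (λ z → PC n (z , mix t v₁ v₂)) (sym x≡)
          (conv-mix {Realised n} 0≤t t≤1 (V∈PC 1 ≤-refl (s≤s z≤n)) (V∈PC (suc N) (s≤s z≤n) ≤-refl)) ,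
        ℚ.*-cancelˡ-≤-pos m {{m-positive}} (ℚ.≤-trans (holds upper) (ℚ.≤-reflexive (sym (begin
          m *ℚ mix t v₁ v₂
            ≡⟨ sym (mix-*ˡ m t v₁ v₂) ⟩
          mix t (m *ℚ v₁) (m *ℚ v₂)
            ≡⟨ cong₂ (mix t) first-tight last-tight ⟩
          mix t (upperRHS n (ℕ→ℚ 1)) (upperRHS n (ℕ→ℚ (suc N)))
            ≡⟨ mix-upperRHS n t (ℕ→ℚ 1) (ℕ→ℚ (suc N)) ⟩
          upperRHS n (mix t (ℕ→ℚ 1) (ℕ→ℚ (suc N)))
            ≡⟨ cong (upperRHS n) (sym x≡) ⟩
          upperRHS n x ∎))))
        where open ≡-Reasoning

    Holds⇒PC : PC n (x , y)
    Holds⇒PC = vertical lower-point upper-point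
      where
      vertical : (∃ λ y₁ → PC n (x , y₁) × y₁ ≤ℚ y) → (∃ λ y₂ → PC n (x , y₂) × y ≤ℚ y₂) → PC n (x , y)
      vertical (y₁ , p₁ , y₁≤y) (y₂ , p₂ , y≤y₂) = go (between y₁≤y y≤y₂)
        where
        mix-idem : ∀ t → mix t x x ≡ x
        mix-idem t = ℚS.solve 2 (λ t x → t ℚS.:* x ℚS.:+ (ℚS.con 1ℚ ℚS.:- t) ℚS.:* x ℚS.:= x) refl t x
        go : (∃ λ t → 0ℚ ≤ℚ t × t ≤ℚ 1ℚ × y ≡ mix t y₁ y₂) → PC n (x , y)
        go (t , 0≤t , t≤1 , y≡) = subst₂ (λ a b → PC n (a , b)) (mix-idem t) (sym y≡) (conv-mix {Realised n} 0≤t t≤1 p₁ p₂)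

-- Facets and their distinctness

module _ (N t : ℕ) (N≡6+t : N ≡ 6 + t) where

  private
    n : ℕ
    n = 2 + N

    6≤N : 6 ≤ N
    6≤N = subst (6 ≤_) (sym N≡6+t) (m≤m+n 6 t)

    Vertex : ℕ → Point
    Vertex a = ℕ→ℚ a , ℕ→ℚ (value N t N≡6+t a)

    Vertex∈ : ∀ a → 1 ≤ a → a ≤ suc N → PC n (Vertex a)
    Vertex∈ = V∈PC N t N≡6+t

    v : ℕ → ℕ
    v = value N t N≡6+t

  Vertex-injective : ∀ {a b} → a ≢ b → Vertex a ≢ Vertex b
  Vertex-injective {a} {b} a≢b e = a≢b (ℤ.+-injective (ℤ→ℚ-injective {+ a} {+ b} (cong proj₁ e)))

  facet : ∀ ι → ∃ λ p → ∃ λ q → PC n p × PC n q × p ≢ q × Tight n ι p × Tight n ι q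
  facet (lower i) = Vertex k , Vertex (suc k) , Vertex∈ k (s≤s z≤n) (m≤n⇒m≤1+n k≤N) , Vertex∈ (suc k) (s≤s z≤n) (s≤s k≤N) ,
    Vertex-injective (<⇒≢ (n<1+n k)) , left-tight N t N≡6+t k k≤N , right-tight N t N≡6+t k k≤N
    where
    k = suc (toℕ i)
    k≤N : k ≤ N
    k≤N = toℕ<n i
  facet upper = Vertex 1 , Vertex (suc N) , Vertex∈ 1 ≤-refl (s≤s z≤n) , Vertex∈ (suc N) (s≤s z≤n) ≤-refl ,
    Vertex-injective (<⇒≢ (s≤s (≤-trans (s≤s z≤n) 6≤N))) , first-tight N t N≡6+t , last-tight N t N≡6+t

  -- The summand `n ∸ a` cancels, so whether `V_a` lies on the lower line `l` does not depend on
  -- `n`.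
  lower-tight-value : ∀ l a → a ≤ n → ℕ→ℚ (v a) ≡ lowerRHS n l (ℕ→ℚ a) → 2 ^ a + 2 ^ l * l ≡ 2 ^ l * suc a
  lower-tight-value l a a≤n tight = +-cancelʳ-≡ (n ∸ a) _ _ (trans
    (solve 3 (λ x y c → x :+ y :+ c := x :+ c :+ y) refl (2 ^ a) (2 ^ l * l) (n ∸ a))
    (lower-tight⁻ {n} l a (n ∸ a) (m+[n∸m]≡n a≤n) (v a) tight))

  -- Two lines through the vertices k and k + 1 have the same slope.
  same-slope : ∀ k l → 2 ^ k + 2 ^ l * l ≡ 2 ^ l * suc k → 2 ^ suc k + 2 ^ l * l ≡ 2 ^ l * suc (suc k) → k ≡ l
  same-slope k l e₁ e₂ = 2^-injective (+-cancelˡ-≡ (2 ^ k + 2 ^ l * l) _ _ (begin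
    2 ^ k + 2 ^ l * l + 2 ^ k     ≡⟨ solve 2 (λ x y → x :+ y :+ x := con 2 :* x :+ y) refl (2 ^ k) (2 ^ l * l) ⟩
    2 ^ suc k + 2 ^ l * l         ≡⟨ e₂ ⟩
    2 ^ l * suc (suc k)           ≡⟨ trans (*-suc (2 ^ l) (suc k)) (+-comm (2 ^ l) _) ⟩
    2 ^ l * suc k + 2 ^ l         ≡⟨ cong (_+ 2 ^ l) (sym e₁) ⟩
    2 ^ k + 2 ^ l * l + 2 ^ l     ∎))
    where open ≡-Reasoning

  -- Line `l` cannot pass through both `V_k` and `V_{k+1}`, so one of them separates; which one is
  -- decided by testing `V_k`.
  lower≢lower : ∀ k l → 1 ≤ k → k ≤ N → k ≢ l →
    ∃ λ p → PC n p × proj₂ p ≡ lowerRHS n k (proj₁ p) × ¬ (proj₂ p ≡ lowerRHS n l (proj₁ p))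
  lower≢lower k l 1≤k k≤N k≢l = go (2 ^ k + 2 ^ l * l ≟ℕ 2 ^ l * suc k)
    where
    k≤n : k ≤ n
    k≤n = ≤-trans k≤N (m≤n+m N 2)
    go : Dec (2 ^ k + 2 ^ l * l ≡ 2 ^ l * suc k) →
      ∃ λ p → PC n p × proj₂ p ≡ lowerRHS n k (proj₁ p) × ¬ (proj₂ p ≡ lowerRHS n l (proj₁ p))
    go (no ¬e) = Vertex k , Vertex∈ k 1≤k (m≤n⇒m≤1+n k≤N) , left-tight N t N≡6+t k k≤N , λ tight → ¬e (lower-tight-value l k k≤n tight)
    go (yes e) = Vertex (suc k) , Vertex∈ (suc k) (s≤s z≤n) (s≤s k≤N) , right-tight N t N≡6+t k k≤N ,
      λ tight → k≢l (same-slope k l e (lower-tight-value l (suc k) (s≤s (m≤n⇒m≤1+n k≤N)) tight))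

  not-upper : ∀ x → 1 ≤ x → x < N → ¬ Tight n upper (Vertex (suc x))
  not-upper x 1≤x x<N tight = upper-strict N x (n ∸ suc x) 1≤x x<N (m+[n∸m]≡n (m≤n⇒m≤1+n (m≤n⇒m≤1+n x<N)))
    (upper-tight⁻ N x (v (suc x)) tight)

  separated : ∀ ι ι′ → ι ≢ ι′ → ∃ λ p → PC n p × Tight n ι p × ¬ Tight n ι′ p
  separated (lower i) (lower j) i≢j = lower≢lower (suc (toℕ i)) (suc (toℕ j)) (s≤s z≤n) (toℕ<n i)
    (λ e → i≢j (cong lower (toℕ-injective (suc-injective e))))
  separated (lower i) upper _ = go (toℕ i) (toℕ<n i)
    where
    go : ∀ k → k < N → ∃ λ p → PC n p × proj₂ p ≡ lowerRHS n (suc k) (proj₁ p) × ¬ Tight n upper p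
    -- `V_1` lies on the upper edge as well, so the right endpoint is taken for `k = 1`; for every
    -- other `k` the left endpoint is an intermediate vertex.
    go zero k<N = Vertex 2 , Vertex∈ 2 (s≤s z≤n) (s≤s k<N) , right-tight N t N≡6+t 1 k<N , not-upper 1 ≤-refl (≤-trans (s≤s (s≤s z≤n)) 6≤N)
    go (suc k) k<N = Vertex (2 + k) , Vertex∈ (2 + k) (s≤s z≤n) (m≤n⇒m≤1+n k<N) , left-tight N t N≡6+t (2 + k) k<N , not-upper (suc k) (s≤s z≤n) k<N
  separated upper (lower j) _ = go (toℕ j)
    where
    go : ∀ l → ∃ λ p → PC n p × Tight n upper p × ¬ (proj₂ p ≡ lowerRHS n (suc l) (proj₁ p))
    -- The line for `k = 1` contains `V_1`, so the other end of the upper edge is used; for `k ≥ 2`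
    -- the vertex `V_1` lies off the line.
    go zero = Vertex (suc N) , Vertex∈ (suc N) (s≤s z≤n) ≤-refl , last-tight N t N≡6+t , λ tight →
      <⇒≢ (*-monoʳ-< 2 (suc<2^ N N≡6+t)) (+-cancelʳ-≡ 2 _ _ (trans
        (solve 1 (λ N → con 2 :* (con 1 :+ N) :+ con 2 := con 2 :* (con 2 :+ N)) refl N)
        (sym (lower-tight-value 1 (suc N) (n≤1+n (suc N)) tight))))
    go (suc l) = Vertex 1 , Vertex∈ 1 ≤-refl (s≤s z≤n) , first-tight N t N≡6+t , λ tight →
      <⇒≢ (s≤s z≤n) (+-cancelʳ-≡ (P l * 2) 0 _ (sym (trans
        (solve 2 (λ P l → con 2 :+ P :* l :+ P :* con 2 := con 2 :+ P :* (con 2 :+ l)) refl (P l) l)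
        (lower-tight-value (2 + l) 1 (s≤s z≤n) tight))))
      where
      P : ℕ → ℕ
      P l = 2 ^ (2 + l)
  separated upper upper upper≢upper = ⊥-elim (upper≢upper refl)

theorem5 : (n : ℕ) → 8 ≤ n →
    ((p : Point) → PC n p ⇔ ((ι : Ineq n) → Holds n ι p))
    × ((ι : Ineq n) → ∃ λ p → ∃ λ q → PC n p × PC n q × p ≢ q × Tight n ι p × Tight n ι q)
    × ((ι ι′ : Ineq n) → ι ≢ ι′ → ∃ λ p → PC n p × Tight n ι p × ¬ Tight n ι′ p)
theorem5 (suc (suc N)) (s≤s (s≤s 6≤N)) =
  (λ p → mk⇔ (PC⇒Holds N t N≡6+t p) (Holds⇒PC N t N≡6+t)) , facet N t N≡6+t , separated N t N≡6+t
  where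
  t : ℕ
  t = N ∸ 6
  N≡6+t : N ≡ 6 + t
  N≡6+t = sym (m+[n∸m]≡n 6≤N)
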